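{- Let $k$ be a perfect field of characteristic $p>0$, $K=W(k)[1/p]$ and $\mathcal{O}_K=W(k)$. Let $$\cdots\subseteq \mathrm{Fil}_0^{\mathrm{conj}}\subseteq\cdots\subseteq\mathrm{Fil}_i^{\mathrm{conj}}\subseteq\cdots\qquad(i\in\mathbf{Z})$$ be an increasing filtration of finite free $\mathcal{O}_K$-modules which is finite, i.e. $\mathrm{Fil}_i^{\mathrm{conj}}$ stabilizes for $i\gg0$ and $\mathrm{Fil}_i^{\mathrm{conj}}=0$ for $i\ll0$. Put $\mathrm{gr}_i^{\mathrm{conj}}=\mathrm{Fil}_i^{\mathrm{conj}}/\mathrm{Fil}_{i-1}^{\mathrm{conj}}$. Assume there is a filtered ($\mathcal{O}_K$-linear) endomorphism $\Theta:\mathrm{Fil}_{\bullet}^{\mathrm{conj}}\to\mathrm{Fil}_{\bullet}^{\mathrm{conj}}$ which acts on $\mathrm{gr}_i^{\mathrm{conj}}$ as multiplication by $-i$ for every $i$. Let $\mathrm{HT}=\{i\in\mathbf{Z} : \mathrm{gr}_i^{\mathrm{conj}}[1/p]\neq0\}$. Then for every $i\in\mathbf{Z}$, if the torsion submodule $(\mathrm{gr}_i^{\mathrm{conj}})_{\mathrm{tor}}$ is nonzero, then $i=r+mp$ for some $r\in\mathrm{HT}$ and some integer $m>0$.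
   Context: A filtered endomorphism means an endomorphism $\Theta$ of the modules $\mathrm{Fil}_i^{\mathrm{conj}}$ compatible with the inclusions, i.e. $\Theta(\mathrm{Fil}_i^{\mathrm{conj}})\subseteq\mathrm{Fil}_i^{\mathrm{conj}}$ for all $i$. -}

module Defs where

open import Level using (Level; _⊔_; suc)
open import Algebra.Bundles using (CommutativeMonoid; CommutativeRing)
open import Algebra.Apartness.Bundles using (HeytingField; HeytingCommutativeRing)
open import Algebra.Module.Bundles using (LeftModule)
open import Algebra.Module.Morphism.Structures using (module LeftModuleMorphisms)
open import Algebra.Morphism.Structures using (module RingMorphisms)
import Algebra.Definitions.RawMagma as RawMagmaDefinitions
import Algebra.Module.Properties.LeftModule as LeftModuleProperties
import Algebra.Properties.AbelianGroup as AbelianGroupProperties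
import Algebra.Properties.CommutativeSemigroup as CommutativeSemigroupProperties
import Algebra.Properties.Semiring.Exp as Exponentiation
import Algebra.Properties.Semiring.Mult as Multiples
open import Data.Fin.Base using (Fin)
open import Data.Integer.Base as ℤ using (ℤ; +_; -[1+_])
open import Data.Nat.Base as ℕ using (ℕ)
import Data.Nat.Divisibility as ℕDivisibility
import Data.Nat.Properties as ℕP
open import Data.Nat.Solver using (module +-*-Solver)
open import Data.Product.Base using (Σ; ∃; ∃-syntax; _×_; _,_; proj₁; proj₂)
open import Function.Bundles using (_⇔_)
open import Function.Definitions using (Surjective)
open import Relation.Binary.PropositionalEquality.Core as ≡ using (_≡_)
import Relation.Binary.Reasoning.Setoid as ≈-Reasoning
open import Relation.Nullary.Negation.Core using (¬_)
open import Relation.Unary using (Pred; _∈_; _⊆_)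

private
  variable
    c ℓ c′ ℓ′ ℓ″ m ℓm m′ ℓm′ q : Level

module _ (R : CommutativeRing c ℓ) where
  open CommutativeRing R
  open Multiples semiring renaming (_×_ to _·_)
  open Exponentiation semiring using (_^_)

  HasCharacteristic : ℕ → Set ℓ
  HasCharacteristic p = ∀ n → (n · 1# ≈ 0#) ⇔ (p ℕDivisibility.∣ n)

  -- For a field of characteristic p the Frobenius map is automatically injective.
  IsPerfect : ℕ → Set (c ⊔ ℓ)
  IsPerfect p = Surjective _≈_ _≈_ (_^ p)

  fromℕ : ℕ → Carrier
  fromℕ n = n · 1#

  fromℤ : ℤ → Carrier
  fromℤ (+ n)    = fromℕ n
  fromℤ -[1+ n ] = - fromℕ (ℕ.suc n)

fieldRing : HeytingField c ℓ ℓ′ → CommutativeRing c ℓ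
fieldRing k = HeytingCommutativeRing.commutativeRing (HeytingField.heytingCommutativeRing k)

-- For k perfect of characteristic p, W(k) is the strict p-ring with residue
-- ring k: the p-torsion-free, p-adically separated and complete ring W with
-- W/pW ≅ k, which is unique up to unique isomorphism over k (Serre, Local
-- Fields, II §5-6).  WittRing k p W exhibits W as such a ring.
record WittRing (k : HeytingField c ℓ ℓ′) (p : ℕ) (W : CommutativeRing c′ ℓ″)
                : Set (c ⊔ ℓ ⊔ c′ ⊔ ℓ″) where
  private
    module k = CommutativeRing (fieldRing k)
    module W = CommutativeRing W
  open W using (Carrier; _≈_; _*_; _-_; 0#)
  open RingMorphisms W.rawRing k.rawRing using (IsRingHomomorphism)
  open RawMagmaDefinitions W.*-rawMagma using (_∣_)
  open Exponentiation W.semiring using (_^_)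

  ϖ : Carrier
  ϖ = fromℕ W p

  field
    residue            : Carrier → k.Carrier
    isRingHomomorphism : IsRingHomomorphism residue
    surjective         : Surjective _≈_ k._≈_ residue
    kernel             : ∀ x → (residue x k.≈ k.0#) ⇔ (ϖ ∣ x)
    p-torsionFree      : ∀ x → ϖ * x ≈ 0# → x ≈ 0#
    separated          : ∀ x → (∀ n → (ϖ ^ n) ∣ x) → x ≈ 0#
    complete           : ∀ (a : ℕ → Carrier) →
                         (∀ n → (ϖ ^ n) ∣ (a (ℕ.suc n) - a n)) →
                         ∃[ x ] (∀ n → (ϖ ^ n) ∣ (x - a n))

module Modules (R : CommutativeRing c ℓ) where
  open CommutativeRing R
  open Exponentiation semiring using (_^_; ^-homo-*)

  Mod : ∀ m ℓm → Set _
  Mod = LeftModule ring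

  IsZero : Mod m ℓm → Set _
  IsZero M = ∀ x → x ≈ᴹ 0ᴹ
    where open LeftModule M

  free : ℕ → Mod c ℓ
  free n = record
    { Carrierᴹ = Fin n → Carrier
    ; _≈ᴹ_     = λ v w → ∀ i → v i ≈ w i
    ; _+ᴹ_     = λ v w i → v i + w i
    ; _*ₗ_     = λ a v i → a * v i
    ; 0ᴹ       = λ _ → 0#
    ; -ᴹ_      = λ v i → - v i
    ; isLeftModule = record
      { isLeftSemimodule = record
        { +ᴹ-isCommutativeMonoid = record
          { isMonoid = record
            { isSemigroup = record
              { isMagma = record
                { isEquivalence = record
                  { refl  = λ _ → refl
                  ; sym   = λ v≈w i → sym (v≈w i)
                  ; trans = λ u≈v v≈w i → trans (u≈v i) (v≈w i)
                  }
                ; ∙-cong = λ v≈v′ w≈w′ i → +-cong (v≈v′ i) (w≈w′ i)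
                }
              ; assoc = λ u v w i → +-assoc (u i) (v i) (w i)
              }
            ; identity = (λ v i → +-identityˡ (v i)) , (λ v i → +-identityʳ (v i))
            }
          ; comm = λ v w i → +-comm (v i) (w i)
          }
        ; isPreleftSemimodule = record
          { *ₗ-cong      = λ a≈b v≈w i → *-cong a≈b (v≈w i)
          ; *ₗ-zeroˡ     = λ v i → zeroˡ (v i)
          ; *ₗ-distribʳ  = λ v a b i → distribʳ (v i) a b
          ; *ₗ-identityˡ = λ v i → *-identityˡ (v i)
          ; *ₗ-assoc     = λ a b v i → *-assoc a b (v i)
          ; *ₗ-zeroʳ     = λ a i → zeroʳ a
          ; *ₗ-distribˡ  = λ a v w i → distribˡ a (v i) (w i)
          }
        }
      ; -ᴹ‿cong    = λ v≈w i → -‿cong (v≈w i)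
      ; -ᴹ‿inverse = (λ v i → -‿inverseˡ (v i)) , (λ v i → -‿inverseʳ (v i))
      }
    }

  IsLinear : (M : Mod m ℓm) (N : Mod m′ ℓm′) →
             (LeftModule.Carrierᴹ M → LeftModule.Carrierᴹ N) → Set _
  IsLinear M N = IsLeftModuleHomomorphism
    where open LeftModuleMorphisms (LeftModule.rawLeftModule M) (LeftModule.rawLeftModule N)

  IsLinearIso : (M : Mod m ℓm) (N : Mod m′ ℓm′) →
                (LeftModule.Carrierᴹ M → LeftModule.Carrierᴹ N) → Set _
  IsLinearIso M N = IsLeftModuleIsomorphism
    where open LeftModuleMorphisms (LeftModule.rawLeftModule M) (LeftModule.rawLeftModule N)

  IsFiniteFree : Mod m ℓm → Set _
  IsFiniteFree M = ∃[ n ] ∃[ f ] IsLinearIso (free n) M f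

  -- The base ring is meant to be an integral domain.
  IsTorsion : (M : Mod m ℓm) → Pred (LeftModule.Carrierᴹ M) _
  IsTorsion M x = ∃[ a ] ((¬ a ≈ 0#) × (a *ₗ x ≈ᴹ 0ᴹ))
    where open LeftModule M

  TorsionIsZero : Mod m ℓm → Set _
  TorsionIsZero M = ∀ x → x ∈ IsTorsion M → x ≈ᴹ 0ᴹ
    where open LeftModule M

  record Submodule (M : Mod m ℓm) q : Set (c ⊔ m ⊔ ℓm ⊔ suc q) where
    open LeftModule M
    field
      Member    : Pred Carrierᴹ q
      resp      : ∀ {x y} → x ≈ᴹ y → x ∈ Member → y ∈ Member
      0-closed  : 0ᴹ ∈ Member
      +-closed  : ∀ {x y} → x ∈ Member → y ∈ Member → (x +ᴹ y) ∈ Member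
      *ₗ-closed : ∀ a {x} → x ∈ Member → (a *ₗ x) ∈ Member

    -closed : ∀ {x} → x ∈ Member → (-ᴹ x) ∈ Member
    -closed {x} x∈ = resp (inverseˡ-uniqueᴹ (- 1# *ₗ x) x (begin
        - 1# *ₗ x +ᴹ x        ≈⟨ +ᴹ-congˡ (≈ᴹ-sym (*ₗ-identityˡ x)) ⟩
        - 1# *ₗ x +ᴹ 1# *ₗ x  ≈⟨ ≈ᴹ-sym (*ₗ-distribʳ x (- 1#) 1#) ⟩
        (- 1# + 1#) *ₗ x      ≈⟨ *ₗ-congʳ (-‿inverseˡ 1#) ⟩
        0# *ₗ x               ≈⟨ *ₗ-zeroˡ x ⟩
        0ᴹ                    ∎))
      (*ₗ-closed (- 1#) x∈)
      where
        open ≈-Reasoning ≈ᴹ-setoid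
        open LeftModuleProperties M using (inverseˡ-uniqueᴹ)

  open Submodule using (Member)

  -- A submodule as a module in its own right, with the equality of M.
  ⟨_⟩ : {M : Mod m ℓm} → Submodule M q → Mod (m ⊔ q) ℓm
  ⟨_⟩ {M = M} N = record
    { Carrierᴹ = Σ Carrierᴹ N.Member
    ; _≈ᴹ_     = λ x y → proj₁ x ≈ᴹ proj₁ y
    ; _+ᴹ_     = λ x y → proj₁ x +ᴹ proj₁ y , N.+-closed (proj₂ x) (proj₂ y)
    ; _*ₗ_     = λ a x → a *ₗ proj₁ x , N.*ₗ-closed a (proj₂ x)
    ; 0ᴹ       = 0ᴹ , N.0-closed
    ; -ᴹ_      = λ x → -ᴹ proj₁ x , N.-closed (proj₂ x)
    ; isLeftModule = record
      { isLeftSemimodule = record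
        { +ᴹ-isCommutativeMonoid = record
          { isMonoid = record
            { isSemigroup = record
              { isMagma = record
                { isEquivalence = record
                  { refl = ≈ᴹ-refl ; sym = ≈ᴹ-sym ; trans = ≈ᴹ-trans }
                ; ∙-cong = +ᴹ-cong
                }
              ; assoc = λ x y z → +ᴹ-assoc (proj₁ x) (proj₁ y) (proj₁ z)
              }
            ; identity = (λ x → +ᴹ-identityˡ (proj₁ x)) , (λ x → +ᴹ-identityʳ (proj₁ x))
            }
          ; comm = λ x y → +ᴹ-comm (proj₁ x) (proj₁ y)
          }
        ; isPreleftSemimodule = record
          { *ₗ-cong      = *ₗ-cong
          ; *ₗ-zeroˡ     = λ x → *ₗ-zeroˡ (proj₁ x)
          ; *ₗ-distribʳ  = λ x → *ₗ-distribʳ (proj₁ x)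
          ; *ₗ-identityˡ = λ x → *ₗ-identityˡ (proj₁ x)
          ; *ₗ-assoc     = λ a b x → *ₗ-assoc a b (proj₁ x)
          ; *ₗ-zeroʳ     = *ₗ-zeroʳ
          ; *ₗ-distribˡ  = λ a x y → *ₗ-distribˡ a (proj₁ x) (proj₁ y)
          }
        }
      ; -ᴹ‿cong    = -ᴹ‿cong
      ; -ᴹ‿inverse = (λ x → -ᴹ‿inverseˡ (proj₁ x)) , (λ x → -ᴹ‿inverseʳ (proj₁ x))
      }
    }
    where
      open LeftModule M
      module N = Submodule N

  -- L ∩ N regarded as a submodule of N.
  restrict : {M : Mod m ℓm} (L N : Submodule M q) → Submodule ⟨ N ⟩ q
  restrict L N = record
    { Member    = λ x → Member L (proj₁ x)
    ; resp      = L.resp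
    ; 0-closed  = L.0-closed
    ; +-closed  = L.+-closed
    ; *ₗ-closed = λ a → L.*ₗ-closed a
    }
    where module L = Submodule L

  infixl 6 _/_
  _/_ : (M : Mod m ℓm) → Submodule M q → Mod m q
  M / N = record
    { Carrierᴹ = Carrierᴹ
    ; _≈ᴹ_     = _∼_
    ; _+ᴹ_     = _+ᴹ_
    ; _*ₗ_     = _*ₗ_
    ; 0ᴹ       = 0ᴹ
    ; -ᴹ_      = -ᴹ_
    ; isLeftModule = record
      { isLeftSemimodule = record
        { +ᴹ-isCommutativeMonoid = record
          { isMonoid = record
            { isSemigroup = record
              { isMagma = record
                { isEquivalence = record
                  { refl = ≈⇒∼ ≈ᴹ-refl ; sym = ∼-sym ; trans = ∼-trans }
                ; ∙-cong = ∼-+-cong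
                }
              ; assoc = λ x y z → ≈⇒∼ (+ᴹ-assoc x y z)
              }
            ; identity = (λ x → ≈⇒∼ (+ᴹ-identityˡ x)) , (λ x → ≈⇒∼ (+ᴹ-identityʳ x))
            }
          ; comm = λ x y → ≈⇒∼ (+ᴹ-comm x y)
          }
        ; isPreleftSemimodule = record
          { *ₗ-cong      = λ {a} {b} {x} {y} a≈b x∼y →
                             ∼-trans (≈⇒∼ (*ₗ-congʳ a≈b)) (∼-*ₗ-cong b x∼y)
          ; *ₗ-zeroˡ     = λ x → ≈⇒∼ (*ₗ-zeroˡ x)
          ; *ₗ-distribʳ  = λ x a b → ≈⇒∼ (*ₗ-distribʳ x a b)
          ; *ₗ-identityˡ = λ x → ≈⇒∼ (*ₗ-identityˡ x)
          ; *ₗ-assoc     = λ a b x → ≈⇒∼ (*ₗ-assoc a b x)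
          ; *ₗ-zeroʳ     = λ a → ≈⇒∼ (*ₗ-zeroʳ a)
          ; *ₗ-distribˡ  = λ a x y → ≈⇒∼ (*ₗ-distribˡ a x y)
          }
        }
      ; -ᴹ‿cong    = ∼-neg-cong
      ; -ᴹ‿inverse = (λ x → ≈⇒∼ (-ᴹ‿inverseˡ x)) , (λ x → ≈⇒∼ (-ᴹ‿inverseʳ x))
      }
    }
    where
      open LeftModule M
      open AbelianGroupProperties +ᴹ-abelianGroup
        using () renaming (⁻¹-involutive to neg-involutive; ⁻¹-∙-comm to neg-distrib)
      open CommutativeSemigroupProperties
        (CommutativeMonoid.commutativeSemigroup +ᴹ-commutativeMonoid)
        using (interchange)
      open ≈-Reasoning ≈ᴹ-setoid
      module N = Submodule N

      _∼_ : Carrierᴹ → Carrierᴹ → Set _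
      x ∼ y = (x +ᴹ -ᴹ y) ∈ N.Member

      ≈⇒∼ : ∀ {x y} → x ≈ᴹ y → x ∼ y
      ≈⇒∼ {x} {y} x≈y =
        N.resp (≈ᴹ-sym (≈ᴹ-trans (+ᴹ-congʳ x≈y) (-ᴹ‿inverseʳ y))) N.0-closed

      ∼-sym : ∀ {x y} → x ∼ y → y ∼ x
      ∼-sym {x} {y} x∼y = N.resp (begin
        -ᴹ (x +ᴹ -ᴹ y)     ≈⟨ ≈ᴹ-sym (neg-distrib x (-ᴹ y)) ⟩
        -ᴹ x +ᴹ -ᴹ (-ᴹ y)  ≈⟨ +ᴹ-congˡ (neg-involutive y) ⟩
        -ᴹ x +ᴹ y          ≈⟨ +ᴹ-comm (-ᴹ x) y ⟩
        y +ᴹ -ᴹ x          ∎) (N.-closed x∼y)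

      ∼-trans : ∀ {x y z} → x ∼ y → y ∼ z → x ∼ z
      ∼-trans {x} {y} {z} x∼y y∼z = N.resp (begin
        (x +ᴹ -ᴹ y) +ᴹ (y +ᴹ -ᴹ z)  ≈⟨ +ᴹ-assoc x (-ᴹ y) (y +ᴹ -ᴹ z) ⟩
        x +ᴹ (-ᴹ y +ᴹ (y +ᴹ -ᴹ z))  ≈⟨ +ᴹ-congˡ (≈ᴹ-sym (+ᴹ-assoc (-ᴹ y) y (-ᴹ z))) ⟩
        x +ᴹ ((-ᴹ y +ᴹ y) +ᴹ -ᴹ z)  ≈⟨ +ᴹ-congˡ (+ᴹ-congʳ (-ᴹ‿inverseˡ y)) ⟩
        x +ᴹ (0ᴹ +ᴹ -ᴹ z)           ≈⟨ +ᴹ-congˡ (+ᴹ-identityˡ (-ᴹ z)) ⟩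
        x +ᴹ -ᴹ z                   ∎) (N.+-closed x∼y y∼z)

      ∼-+-cong : ∀ {x x′ y y′} → x ∼ x′ → y ∼ y′ → (x +ᴹ y) ∼ (x′ +ᴹ y′)
      ∼-+-cong {x} {x′} {y} {y′} x∼x′ y∼y′ = N.resp (begin
        (x +ᴹ -ᴹ x′) +ᴹ (y +ᴹ -ᴹ y′)  ≈⟨ interchange x (-ᴹ x′) y (-ᴹ y′) ⟩
        (x +ᴹ y) +ᴹ (-ᴹ x′ +ᴹ -ᴹ y′)  ≈⟨ +ᴹ-congˡ (neg-distrib x′ y′) ⟩
        (x +ᴹ y) +ᴹ -ᴹ (x′ +ᴹ y′)     ∎) (N.+-closed x∼x′ y∼y′)

      ∼-neg-cong : ∀ {x y} → x ∼ y → (-ᴹ x) ∼ (-ᴹ y)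
      ∼-neg-cong {x} {y} x∼y =
        N.resp (≈ᴹ-sym (neg-distrib x (-ᴹ y))) (N.-closed x∼y)

      *ₗ-neg : ∀ a y → (a *ₗ -ᴹ y) ≈ᴹ -ᴹ (a *ₗ y)
      *ₗ-neg a y = LeftModuleProperties.inverseˡ-uniqueᴹ M (a *ₗ -ᴹ y) (a *ₗ y) (begin
        a *ₗ -ᴹ y +ᴹ a *ₗ y  ≈⟨ ≈ᴹ-sym (*ₗ-distribˡ a (-ᴹ y) y) ⟩
        a *ₗ (-ᴹ y +ᴹ y)     ≈⟨ *ₗ-congˡ (-ᴹ‿inverseˡ y) ⟩
        a *ₗ 0ᴹ              ≈⟨ *ₗ-zeroʳ a ⟩
        0ᴹ                   ∎)

      ∼-*ₗ-cong : ∀ a {x y} → x ∼ y → (a *ₗ x) ∼ (a *ₗ y)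
      ∼-*ₗ-cong a {x} {y} x∼y = N.resp (begin
        a *ₗ (x +ᴹ -ᴹ y)        ≈⟨ *ₗ-distribˡ a x (-ᴹ y) ⟩
        a *ₗ x +ᴹ a *ₗ -ᴹ y     ≈⟨ +ᴹ-congˡ (*ₗ-neg a y) ⟩
        a *ₗ x +ᴹ -ᴹ (a *ₗ y)   ∎) (N.*ₗ-closed a x∼y)

  -- M[1/s]; the pair (x , n) stands for x / sⁿ.
  _[1/_] : Mod m ℓm → Carrier → Mod m ℓm
  M [1/ s ] = record
    { Carrierᴹ = Carrierᴹ × ℕ
    ; _≈ᴹ_     = _∼_
    ; _+ᴹ_     = _⊞_
    ; _*ₗ_     = λ a (x , n) → a *ₗ x , n
    ; 0ᴹ       = 0ᴹ , 0
    ; -ᴹ_      = λ (x , n) → -ᴹ x , n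
    ; isLeftModule = record
      { isLeftSemimodule = record
        { +ᴹ-isCommutativeMonoid = record
          { isMonoid = record
            { isSemigroup = record
              { isMagma = record
                { isEquivalence = record
                  { refl = 0 , ≈ᴹ-refl ; sym = λ (l , e) → l , ≈ᴹ-sym e ; trans = ∼-trans }
                ; ∙-cong = ∼-+-cong
                }
              ; assoc = ⊞-assoc
              }
            ; identity = ⊞-identityˡ , λ u → ∼-trans (⊞-comm u (0ᴹ , 0)) (⊞-identityˡ u)
            }
          ; comm = ⊞-comm
          }
        ; isPreleftSemimodule = record
          { *ₗ-cong      = λ {a} {b} {(x , m)} {(y , n)} a≈b (l , e) → l , (begin
              s ^ (l ℕ.+ n) *ₗ a *ₗ x  ≈⟨ swap (l ℕ.+ n) a x ⟩
              a *ₗ s ^ (l ℕ.+ n) *ₗ x  ≈⟨ *ₗ-cong a≈b e ⟩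
              b *ₗ s ^ (l ℕ.+ m) *ₗ y  ≈⟨ ≈ᴹ-sym (swap (l ℕ.+ m) b y) ⟩
              s ^ (l ℕ.+ m) *ₗ b *ₗ y  ∎)
          ; *ₗ-zeroˡ     = λ (x , n) → zero∼ n (*ₗ-zeroˡ x)
          ; *ₗ-distribʳ  = λ (x , n) a b → 0 , (begin
              s ^ (n ℕ.+ n) *ₗ (a + b) *ₗ x
                ≈⟨ *ₗ-congˡ (*ₗ-distribʳ x a b) ⟩
              s ^ (n ℕ.+ n) *ₗ (a *ₗ x +ᴹ b *ₗ x)
                ≈⟨ ≈ᴹ-sym (merge n n ≡.refl) ⟩
              s ^ n *ₗ s ^ n *ₗ (a *ₗ x +ᴹ b *ₗ x)
                ≈⟨ *ₗ-congˡ (*ₗ-distribˡ (s ^ n) (a *ₗ x) (b *ₗ x)) ⟩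
              s ^ n *ₗ (s ^ n *ₗ a *ₗ x +ᴹ s ^ n *ₗ b *ₗ x)  ∎)
          ; *ₗ-identityˡ = λ (x , n) → numerator n (*ₗ-identityˡ x)
          ; *ₗ-assoc     = λ a b (x , n) → numerator n (*ₗ-assoc a b x)
          ; *ₗ-zeroʳ     = λ a → numerator 0 (*ₗ-zeroʳ a)
          ; *ₗ-distribˡ  = λ a (x , m) (y , n) → numerator (m ℕ.+ n) (begin
              a *ₗ (s ^ n *ₗ x +ᴹ s ^ m *ₗ y)
                ≈⟨ *ₗ-distribˡ a (s ^ n *ₗ x) (s ^ m *ₗ y) ⟩
              a *ₗ s ^ n *ₗ x +ᴹ a *ₗ s ^ m *ₗ y
                ≈⟨ ≈ᴹ-sym (+ᴹ-cong (swap n a x) (swap m a y)) ⟩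
              s ^ n *ₗ a *ₗ x +ᴹ s ^ m *ₗ a *ₗ y  ∎)
          }
        }
      ; -ᴹ‿cong    = λ {(x , m)} {(y , n)} (l , e) → l , (begin
          s ^ (l ℕ.+ n) *ₗ -ᴹ x    ≈⟨ *ₗ-neg (l ℕ.+ n) x ⟩
          -ᴹ (s ^ (l ℕ.+ n) *ₗ x)  ≈⟨ -ᴹ‿cong e ⟩
          -ᴹ (s ^ (l ℕ.+ m) *ₗ y)  ≈⟨ ≈ᴹ-sym (*ₗ-neg (l ℕ.+ m) y) ⟩
          s ^ (l ℕ.+ m) *ₗ -ᴹ y    ∎)
      ; -ᴹ‿inverse = ⊞-inverseˡ
                   , λ u@(x , n) → ∼-trans (⊞-comm u (-ᴹ x , n)) (⊞-inverseˡ u)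
      }
    }
    where
      open LeftModule M
      open ≈-Reasoning ≈ᴹ-setoid
      open +-*-Solver using (solve; _:=_; _:+_)

      _∼_ : Carrierᴹ × ℕ → Carrierᴹ × ℕ → Set _
      (x , m) ∼ (y , n) = ∃[ l ] (s ^ (l ℕ.+ n) *ₗ x ≈ᴹ s ^ (l ℕ.+ m) *ₗ y)

      _⊞_ : Carrierᴹ × ℕ → Carrierᴹ × ℕ → Carrierᴹ × ℕ
      (x , m) ⊞ (y , n) = s ^ n *ₗ x +ᴹ s ^ m *ₗ y , m ℕ.+ n

      merge : ∀ i j {k x} → i ℕ.+ j ≡ k → s ^ i *ₗ s ^ j *ₗ x ≈ᴹ s ^ k *ₗ x
      merge i j {x = x} ≡.refl =
        ≈ᴹ-trans (≈ᴹ-sym (*ₗ-assoc (s ^ i) (s ^ j) x)) (*ₗ-congʳ (sym (^-homo-* s i j)))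

      swap : ∀ n a x → s ^ n *ₗ a *ₗ x ≈ᴹ a *ₗ s ^ n *ₗ x
      swap n a x = begin
        s ^ n *ₗ a *ₗ x    ≈⟨ ≈ᴹ-sym (*ₗ-assoc (s ^ n) a x) ⟩
        (s ^ n * a) *ₗ x   ≈⟨ *ₗ-congʳ (*-comm (s ^ n) a) ⟩
        (a * s ^ n) *ₗ x   ≈⟨ *ₗ-assoc a (s ^ n) x ⟩
        a *ₗ s ^ n *ₗ x    ∎

      numerator : ∀ n {x y} → x ≈ᴹ y → (x , n) ∼ (y , n)
      numerator n x≈y = 0 , *ₗ-congˡ x≈y

      zero∼ : ∀ n {x} → x ≈ᴹ 0ᴹ → (x , n) ∼ (0ᴹ , 0)
      zero∼ n {x} x≈0 = 0 , (begin
        s ^ 0 *ₗ x   ≈⟨ *ₗ-congˡ x≈0 ⟩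
        s ^ 0 *ₗ 0ᴹ  ≈⟨ *ₗ-zeroʳ (s ^ 0) ⟩
        0ᴹ           ≈⟨ ≈ᴹ-sym (*ₗ-zeroʳ (s ^ n)) ⟩
        s ^ n *ₗ 0ᴹ  ∎)

      *ₗ-neg : ∀ n x → s ^ n *ₗ -ᴹ x ≈ᴹ -ᴹ (s ^ n *ₗ x)
      *ₗ-neg n x = LeftModuleProperties.inverseˡ-uniqueᴹ M (s ^ n *ₗ -ᴹ x) (s ^ n *ₗ x) (begin
        s ^ n *ₗ -ᴹ x +ᴹ s ^ n *ₗ x  ≈⟨ ≈ᴹ-sym (*ₗ-distribˡ (s ^ n) (-ᴹ x) x) ⟩
        s ^ n *ₗ (-ᴹ x +ᴹ x)         ≈⟨ *ₗ-congˡ (-ᴹ‿inverseˡ x) ⟩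
        s ^ n *ₗ 0ᴹ                  ≈⟨ *ₗ-zeroʳ (s ^ n) ⟩
        0ᴹ                           ∎)

      ∼-trans : ∀ {u v w} → u ∼ v → v ∼ w → u ∼ w
      ∼-trans {x , m} {y , n} {z , o} (k , e) (l , f) = k ℕ.+ l ℕ.+ n , (begin
        s ^ (k ℕ.+ l ℕ.+ n ℕ.+ o) *ₗ x
          ≈⟨ ≈ᴹ-sym (merge (l ℕ.+ o) (k ℕ.+ n) (solve 4 (λ k l n o →
               (l :+ o) :+ (k :+ n) := k :+ l :+ n :+ o) ≡.refl k l n o)) ⟩
        s ^ (l ℕ.+ o) *ₗ s ^ (k ℕ.+ n) *ₗ x   ≈⟨ *ₗ-congˡ e ⟩
        s ^ (l ℕ.+ o) *ₗ s ^ (k ℕ.+ m) *ₗ y   ≈⟨ swap (l ℕ.+ o) (s ^ (k ℕ.+ m)) y ⟩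
        s ^ (k ℕ.+ m) *ₗ s ^ (l ℕ.+ o) *ₗ y   ≈⟨ *ₗ-congˡ f ⟩
        s ^ (k ℕ.+ m) *ₗ s ^ (l ℕ.+ n) *ₗ z
          ≈⟨ merge (k ℕ.+ m) (l ℕ.+ n) (solve 4 (λ k l m n →
               (k :+ m) :+ (l :+ n) := k :+ l :+ n :+ m) ≡.refl k l m n) ⟩
        s ^ (k ℕ.+ l ℕ.+ n ℕ.+ m) *ₗ z        ∎)

      ∼-+-cong : ∀ {u u′ v v′} → u ∼ u′ → v ∼ v′ → (u ⊞ v) ∼ (u′ ⊞ v′)
      ∼-+-cong {x , m} {x′ , m′} {y , n} {y′ , n′} (k , e) (l , f) = k ℕ.+ l , (begin
        s ^ (k ℕ.+ l ℕ.+ (m′ ℕ.+ n′)) *ₗ (s ^ n *ₗ x +ᴹ s ^ m *ₗ y)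
          ≈⟨ *ₗ-distribˡ _ _ _ ⟩
        s ^ (k ℕ.+ l ℕ.+ (m′ ℕ.+ n′)) *ₗ s ^ n *ₗ x
          +ᴹ s ^ (k ℕ.+ l ℕ.+ (m′ ℕ.+ n′)) *ₗ s ^ m *ₗ y
          ≈⟨ +ᴹ-cong (left e) (right f) ⟩
        s ^ (k ℕ.+ l ℕ.+ (m ℕ.+ n)) *ₗ s ^ n′ *ₗ x′
          +ᴹ s ^ (k ℕ.+ l ℕ.+ (m ℕ.+ n)) *ₗ s ^ m′ *ₗ y′
          ≈⟨ ≈ᴹ-sym (*ₗ-distribˡ _ _ _) ⟩
        s ^ (k ℕ.+ l ℕ.+ (m ℕ.+ n)) *ₗ (s ^ n′ *ₗ x′ +ᴹ s ^ m′ *ₗ y′)  ∎)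
        where
          left : s ^ (k ℕ.+ m′) *ₗ x ≈ᴹ s ^ (k ℕ.+ m) *ₗ x′ →
                 s ^ (k ℕ.+ l ℕ.+ (m′ ℕ.+ n′)) *ₗ s ^ n *ₗ x ≈ᴹ
                 s ^ (k ℕ.+ l ℕ.+ (m ℕ.+ n)) *ₗ s ^ n′ *ₗ x′
          left e = begin
            s ^ (k ℕ.+ l ℕ.+ (m′ ℕ.+ n′)) *ₗ s ^ n *ₗ x
              ≈⟨ merge (k ℕ.+ l ℕ.+ (m′ ℕ.+ n′)) n ≡.refl ⟩
            s ^ (k ℕ.+ l ℕ.+ (m′ ℕ.+ n′) ℕ.+ n) *ₗ x
              ≈⟨ ≈ᴹ-sym (merge (l ℕ.+ n ℕ.+ n′) (k ℕ.+ m′) (solve 5 (λ k l m′ n n′ →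
                   (l :+ n :+ n′) :+ (k :+ m′) := k :+ l :+ (m′ :+ n′) :+ n)
                   ≡.refl k l m′ n n′)) ⟩
            s ^ (l ℕ.+ n ℕ.+ n′) *ₗ s ^ (k ℕ.+ m′) *ₗ x   ≈⟨ *ₗ-congˡ e ⟩
            s ^ (l ℕ.+ n ℕ.+ n′) *ₗ s ^ (k ℕ.+ m) *ₗ x′
              ≈⟨ merge (l ℕ.+ n ℕ.+ n′) (k ℕ.+ m) (solve 5 (λ k l m n n′ →
                   (l :+ n :+ n′) :+ (k :+ m) := k :+ l :+ (m :+ n) :+ n′)
                   ≡.refl k l m n n′) ⟩
            s ^ (k ℕ.+ l ℕ.+ (m ℕ.+ n) ℕ.+ n′) *ₗ x′
              ≈⟨ ≈ᴹ-sym (merge (k ℕ.+ l ℕ.+ (m ℕ.+ n)) n′ ≡.refl) ⟩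
            s ^ (k ℕ.+ l ℕ.+ (m ℕ.+ n)) *ₗ s ^ n′ *ₗ x′  ∎

          right : s ^ (l ℕ.+ n′) *ₗ y ≈ᴹ s ^ (l ℕ.+ n) *ₗ y′ →
                  s ^ (k ℕ.+ l ℕ.+ (m′ ℕ.+ n′)) *ₗ s ^ m *ₗ y ≈ᴹ
                  s ^ (k ℕ.+ l ℕ.+ (m ℕ.+ n)) *ₗ s ^ m′ *ₗ y′
          right f = begin
            s ^ (k ℕ.+ l ℕ.+ (m′ ℕ.+ n′)) *ₗ s ^ m *ₗ y
              ≈⟨ merge (k ℕ.+ l ℕ.+ (m′ ℕ.+ n′)) m ≡.refl ⟩
            s ^ (k ℕ.+ l ℕ.+ (m′ ℕ.+ n′) ℕ.+ m) *ₗ y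
              ≈⟨ ≈ᴹ-sym (merge (k ℕ.+ m ℕ.+ m′) (l ℕ.+ n′) (solve 5 (λ k l m m′ n′ →
                   (k :+ m :+ m′) :+ (l :+ n′) := k :+ l :+ (m′ :+ n′) :+ m)
                   ≡.refl k l m m′ n′)) ⟩
            s ^ (k ℕ.+ m ℕ.+ m′) *ₗ s ^ (l ℕ.+ n′) *ₗ y   ≈⟨ *ₗ-congˡ f ⟩
            s ^ (k ℕ.+ m ℕ.+ m′) *ₗ s ^ (l ℕ.+ n) *ₗ y′
              ≈⟨ merge (k ℕ.+ m ℕ.+ m′) (l ℕ.+ n) (solve 5 (λ k l m m′ n →
                   (k :+ m :+ m′) :+ (l :+ n) := k :+ l :+ (m :+ n) :+ m′)
                   ≡.refl k l m m′ n) ⟩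
            s ^ (k ℕ.+ l ℕ.+ (m ℕ.+ n) ℕ.+ m′) *ₗ y′
              ≈⟨ ≈ᴹ-sym (merge (k ℕ.+ l ℕ.+ (m ℕ.+ n)) m′ ≡.refl) ⟩
            s ^ (k ℕ.+ l ℕ.+ (m ℕ.+ n)) *ₗ s ^ m′ *ₗ y′  ∎

      sameDenominator : ∀ {m n x y} → m ≡ n → x ≈ᴹ y → (x , m) ∼ (y , n)
      sameDenominator {m} ≡.refl x≈y = numerator m x≈y

      ⊞-assoc : ∀ u v w → ((u ⊞ v) ⊞ w) ∼ (u ⊞ (v ⊞ w))
      ⊞-assoc (x , m) (y , n) (z , o) = sameDenominator (ℕP.+-assoc m n o) (begin
        s ^ o *ₗ (s ^ n *ₗ x +ᴹ s ^ m *ₗ y) +ᴹ s ^ (m ℕ.+ n) *ₗ z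
          ≈⟨ +ᴹ-congʳ (*ₗ-distribˡ _ _ _) ⟩
        s ^ o *ₗ s ^ n *ₗ x +ᴹ s ^ o *ₗ s ^ m *ₗ y +ᴹ s ^ (m ℕ.+ n) *ₗ z
          ≈⟨ +ᴹ-cong (+ᴹ-cong (merge o n (ℕP.+-comm o n)) (swap o (s ^ m) y))
                     (≈ᴹ-sym (merge m n ≡.refl)) ⟩
        s ^ (n ℕ.+ o) *ₗ x +ᴹ s ^ m *ₗ s ^ o *ₗ y +ᴹ s ^ m *ₗ s ^ n *ₗ z
          ≈⟨ +ᴹ-assoc _ _ _ ⟩
        s ^ (n ℕ.+ o) *ₗ x +ᴹ (s ^ m *ₗ s ^ o *ₗ y +ᴹ s ^ m *ₗ s ^ n *ₗ z)
          ≈⟨ +ᴹ-congˡ (≈ᴹ-sym (*ₗ-distribˡ _ _ _)) ⟩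
        s ^ (n ℕ.+ o) *ₗ x +ᴹ s ^ m *ₗ (s ^ o *ₗ y +ᴹ s ^ n *ₗ z)  ∎)

      ⊞-comm : ∀ u v → (u ⊞ v) ∼ (v ⊞ u)
      ⊞-comm (x , m) (y , n) = sameDenominator (ℕP.+-comm m n) (+ᴹ-comm _ _)

      ⊞-identityˡ : ∀ u → ((0ᴹ , 0) ⊞ u) ∼ u
      ⊞-identityˡ (x , n) = numerator n (begin
        s ^ n *ₗ 0ᴹ +ᴹ 1# *ₗ x  ≈⟨ +ᴹ-cong (*ₗ-zeroʳ (s ^ n)) (*ₗ-identityˡ x) ⟩
        0ᴹ +ᴹ x                 ≈⟨ +ᴹ-identityˡ x ⟩
        x                       ∎)

      ⊞-inverseˡ : ∀ u → ((-ᴹ proj₁ u , proj₂ u) ⊞ u) ∼ (0ᴹ , 0)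
      ⊞-inverseˡ (x , n) = zero∼ (n ℕ.+ n) (begin
        s ^ n *ₗ -ᴹ x +ᴹ s ^ n *ₗ x  ≈⟨ ≈ᴹ-sym (*ₗ-distribˡ _ _ _) ⟩
        s ^ n *ₗ (-ᴹ x +ᴹ x)         ≈⟨ *ₗ-congˡ (-ᴹ‿inverseˡ x) ⟩
        s ^ n *ₗ 0ᴹ                  ≈⟨ *ₗ-zeroʳ (s ^ n) ⟩
        0ᴹ                           ∎)

  -- The modules Fil i are realised as submodules of their union M.
  record FiniteFiltration (M : Mod m ℓm) q : Set (c ⊔ ℓ ⊔ m ⊔ ℓm ⊔ suc q) where
    open LeftModule M
    field
      Fil        : ℤ → Submodule M q
      increasing : ∀ i → Member (Fil i) ⊆ Member (Fil (ℤ.suc i))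
      exhaustive : ∀ x → ∃[ i ] (x ∈ Member (Fil i))
      finiteFree : ∀ i → IsFiniteFree ⟨ Fil i ⟩
      stabilizes : ∃[ n ] (∀ i → n ℤ.≤ i → Member (Fil i) ⊆ Member (Fil n))
      vanishes   : ∃[ n ] (∀ i → i ℤ.≤ n → IsZero ⟨ Fil i ⟩)

    gr : ℤ → Mod (m ⊔ q) q
    gr i = ⟨ Fil i ⟩ / restrict (Fil (ℤ.pred i)) (Fil i)

    HT : Carrier → Pred ℤ _
    HT s i = ¬ IsZero (gr i [1/ s ])

  record FilteredEndomorphism {M : Mod m ℓm} (F : FiniteFiltration M q)
                              : Set (c ⊔ m ⊔ ℓm ⊔ q) where
    open LeftModule M
    open FiniteFiltration F
    field
      Θ         : Carrierᴹ → Carrierᴹ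
      isLinear  : IsLinear M M Θ
      preserves : ∀ i {x} → x ∈ Member (Fil i) → Θ x ∈ Member (Fil i)

    grΘ : ∀ i → LeftModule.Carrierᴹ (gr i) → LeftModule.Carrierᴹ (gr i)
    grΘ i (x , x∈) = Θ x , preserves i x∈

  ActsOnGrByNegIndex : {M : Mod m ℓm} {F : FiniteFiltration M q} →
                       FilteredEndomorphism F → Set _
  ActsOnGrByNegIndex {F = F} E =
    ∀ i x → let open LeftModule (gr i) in grΘ i x ≈ᴹ fromℤ R (ℤ.- i) *ₗ x
    where
      open FiniteFiltration F
      open FilteredEndomorphism E

{-# OPTIONS --safe #-}

-- Let T = Θ + i.  Going up the filtration one builds a filtered left inverse S
-- of T on Fil j for j < i: since Θ + j maps Fil j into Fil (j - 1) and
-- T - (Θ + j) = i - j, the operator (i - j)⁻¹ (1 - S (Θ + j)) is a left inverse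
-- on Fil j when S is one on Fil (j - 1) and p ∤ i - j; and S itself still works
-- on Fil j when gr j is torsion.  So S exists on Fil (i - 1) unless some j < i
-- in HT is congruent to i modulo p.  If a x ∈ Fil (i - 1) with x ∈ Fil i and
-- a ≠ 0, then S (T x) = x by torsion-freeness, and T x ∈ Fil (i - 1), whence
-- x ∈ Fil (i - 1): gr i is torsion-free.
--
-- Constructively, membership in HT is decided by comparing the given ranks of
-- Fil (j - 1) and Fil j; equality in W(k) is ¬¬-stable because the apartness of
-- k is tight, but an element outside pW(k) is only ¬¬-invertible.

module Submission where

open import Defs
open import Level using (Level; _⊔_)
open import Algebra.Apartness.Bundles using (HeytingField)
import Algebra.Apartness.Properties.HeytingCommutativeRing as HeytingProperties
open import Algebra.Bundles using (CommutativeMonoid; CommutativeRing)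
open import Algebra.Module.Bundles using (LeftModule)
open import Algebra.Module.Morphism.Construct.Composition using (isLeftModuleHomomorphism)
open import Algebra.Module.Morphism.Structures using (module LeftModuleMorphisms)
open import Algebra.Morphism.Structures using (module RingMorphisms)
import Algebra.Properties.AbelianGroup as AbelianGroupProperties
import Algebra.Properties.CommutativeSemigroup as CommutativeSemigroupProperties
import Algebra.Properties.CommutativeSemigroup.Divisibility as SemigroupDivisibility
import Algebra.Properties.Ring as RingProperties
import Algebra.Properties.Semiring.Divisibility as Divisibility
import Algebra.Properties.Semiring.Exp as Exponentiation
open import Data.Fin.Base using (Fin; zero; suc; punchIn; punchOut)
open import Data.Fin.Properties using (_≟_; punchIn-punchOut)
open import Data.Integer.Base as ℤ using (ℤ; +_; -[1+_])
import Data.Integer.Properties as ℤP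
open import Data.Nat.Base as ℕ using (ℕ; zero; suc)
import Data.Nat.Divisibility as ℕDivisibility
import Data.Nat.Properties as ℕP
open import Data.Product.Base using (∃-syntax; _×_; _,_; proj₁; proj₂)
open import Data.Sum.Base using (_⊎_; inj₁; inj₂)
open import Data.Vec.Functional using (_∷_; tail)
open import Function.Base using (_∘_)
open import Function.Bundles using (Equivalence)
open import Relation.Binary.PropositionalEquality.Core as ≡ using (_≡_)
import Relation.Binary.Reasoning.Setoid as ≈-Reasoning
open import Relation.Nullary.Decidable.Core using (yes; no)
open import Relation.Nullary.Negation.Core using (¬_; contradiction)
open import Relation.Unary using (_∈_; _⊆_)

private
  variable
    c ℓ ℓ′ w ℓw m ℓm m′ ℓm′ m″ ℓm″ q : Level

module LinearMaps (R : CommutativeRing c ℓ) where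
  open CommutativeRing R hiding (zero)
  open Modules R
  open LeftModuleMorphisms.IsLeftModuleHomomorphism public
    using (⟦⟧-cong; +ᴹ-homo; *ₗ-homo; 0ᴹ-homo; -ᴹ-homo)

  module ModuleProperties (M : Mod m ℓm) where
    open LeftModule M
    open CommutativeSemigroupProperties
      (CommutativeMonoid.commutativeSemigroup +ᴹ-commutativeMonoid) public
      using (interchange)
    open AbelianGroupProperties +ᴹ-abelianGroup public
      using () renaming (x∙y⁻¹≈ε⇒x≈y to x-y≈0⇒x≈y; x≈y⇒x∙y⁻¹≈ε to x≈y⇒x-y≈0; ⁻¹-∙-comm to -ᴹ-distrib; ε⁻¹≈ε to -0≈0;
                         inverseˡ-unique to inverseˡ-uniqueᴹ)

    infixl 6 _-ᴹ_
    _-ᴹ_ : Carrierᴹ → Carrierᴹ → Carrierᴹ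
    x -ᴹ y = x +ᴹ -ᴹ y

    -ᴹ-cong : ∀ {x x′ y y′} → x ≈ᴹ x′ → y ≈ᴹ y′ → x -ᴹ y ≈ᴹ x′ -ᴹ y′
    -ᴹ-cong x≈x′ y≈y′ = +ᴹ-cong x≈x′ (-ᴹ‿cong y≈y′)

    *ₗ-comm : ∀ a b x → a *ₗ b *ₗ x ≈ᴹ b *ₗ a *ₗ x
    *ₗ-comm a b x = begin
      a *ₗ b *ₗ x    ≈⟨ *ₗ-assoc a b x ⟨
      (a * b) *ₗ x   ≈⟨ *ₗ-congʳ (*-comm a b) ⟩
      (b * a) *ₗ x   ≈⟨ *ₗ-assoc b a x ⟩
      b *ₗ a *ₗ x    ∎
      where open ≈-Reasoning ≈ᴹ-setoid

    *ₗ--ᴹ : ∀ a x → a *ₗ -ᴹ x ≈ᴹ -ᴹ (a *ₗ x)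
    *ₗ--ᴹ a x = inverseˡ-uniqueᴹ (a *ₗ -ᴹ x) (a *ₗ x) (begin
      a *ₗ -ᴹ x +ᴹ a *ₗ x  ≈⟨ *ₗ-distribˡ a (-ᴹ x) x ⟨
      a *ₗ (-ᴹ x +ᴹ x)     ≈⟨ *ₗ-congˡ (-ᴹ‿inverseˡ x) ⟩
      a *ₗ 0ᴹ              ≈⟨ *ₗ-zeroʳ a ⟩
      0ᴹ                   ∎)
      where open ≈-Reasoning ≈ᴹ-setoid

    *ₗ-distribˡ-ᴹ : ∀ a x y → a *ₗ (x -ᴹ y) ≈ᴹ a *ₗ x -ᴹ a *ₗ y
    *ₗ-distribˡ-ᴹ a x y = ≈ᴹ-trans (*ₗ-distribˡ a x (-ᴹ y)) (+ᴹ-congˡ (*ₗ--ᴹ a y))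

    -1*ₗ : ∀ x → - 1# *ₗ x ≈ᴹ -ᴹ x
    -1*ₗ x = inverseˡ-uniqueᴹ (- 1# *ₗ x) x (begin
      - 1# *ₗ x +ᴹ x        ≈⟨ +ᴹ-congˡ (*ₗ-identityˡ x) ⟨
      - 1# *ₗ x +ᴹ 1# *ₗ x  ≈⟨ *ₗ-distribʳ x (- 1#) 1# ⟨
      (- 1# + 1#) *ₗ x      ≈⟨ *ₗ-congʳ (-‿inverseˡ 1#) ⟩
      0# *ₗ x               ≈⟨ *ₗ-zeroˡ x ⟩
      0ᴹ                    ∎)
      where open ≈-Reasoning ≈ᴹ-setoid

  module _ (M : Mod m ℓm) (N : Mod m′ ℓm′) where
    private
      module M = LeftModule M
      module N = LeftModule N

    linear : {f : M.Carrierᴹ → N.Carrierᴹ} →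
             (∀ {x y} → x M.≈ᴹ y → f x N.≈ᴹ f y) →
             (∀ x y → f (x M.+ᴹ y) N.≈ᴹ f x N.+ᴹ f y) →
             (∀ a x → f (a M.*ₗ x) N.≈ᴹ a N.*ₗ f x) →
             IsLinear M N f
    linear {f} cong homo-+ homo-* = record
      { +ᴹ-isGroupHomomorphism = record
        { isMonoidHomomorphism = record
          { isMagmaHomomorphism = record
            { isRelHomomorphism = record { cong = cong }
            ; homo = homo-+
            }
          ; ε-homo = begin
              f M.0ᴹ            ≈⟨ cong (M.*ₗ-zeroˡ M.0ᴹ) ⟨
              f (0# M.*ₗ M.0ᴹ)  ≈⟨ homo-* 0# M.0ᴹ ⟩
              0# N.*ₗ f M.0ᴹ    ≈⟨ N.*ₗ-zeroˡ (f M.0ᴹ) ⟩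
              N.0ᴹ              ∎
          }
        ; ⁻¹-homo = λ x → begin
            f (M.-ᴹ x)          ≈⟨ cong (-1*ₗ M x) ⟨
            f (- 1# M.*ₗ x)     ≈⟨ homo-* (- 1#) x ⟩
            - 1# N.*ₗ f x       ≈⟨ -1*ₗ N (f x) ⟩
            N.-ᴹ f x            ∎
        }
      ; *ₗ-homo = homo-*
      }
      where
        open ModuleProperties using (-1*ₗ)
        open ≈-Reasoning N.≈ᴹ-setoid

    TrivialKernel : (M.Carrierᴹ → N.Carrierᴹ) → Set _
    TrivialKernel f = ∀ x → f x N.≈ᴹ N.0ᴹ → x M.≈ᴹ M.0ᴹ

  module _ {L : Mod m ℓm} {M : Mod m′ ℓm′} {N : Mod m″ ℓm″} where
    private
      module L = LeftModule L
      module M = LeftModule M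
      module N = LeftModule N

    kernel⇒injective : {f : M.Carrierᴹ → N.Carrierᴹ} → IsLinear M N f → TrivialKernel M N f →
                       ∀ {x y} → f x N.≈ᴹ f y → x M.≈ᴹ y
    kernel⇒injective {f} f-lin f-ker {x} {y} fx≈fy =
      ModuleProperties.x-y≈0⇒x≈y M x y (f-ker (x M.+ᴹ M.-ᴹ y) (begin
        f (x M.+ᴹ M.-ᴹ y)       ≈⟨ +ᴹ-homo f-lin x (M.-ᴹ y) ⟩
        f x N.+ᴹ f (M.-ᴹ y)     ≈⟨ N.+ᴹ-congˡ (-ᴹ-homo f-lin y) ⟩
        f x N.+ᴹ N.-ᴹ (f y)     ≈⟨ ModuleProperties.x≈y⇒x-y≈0 N fx≈fy ⟩
        N.0ᴹ                    ∎))
      where open ≈-Reasoning N.≈ᴹ-setoid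

    factor-linear : {f : M.Carrierᴹ → N.Carrierᴹ} {h : L.Carrierᴹ → N.Carrierᴹ}
                    {g : L.Carrierᴹ → M.Carrierᴹ} →
                    IsLinear M N f → TrivialKernel M N f → IsLinear L N h →
                    (∀ x → f (g x) N.≈ᴹ h x) → IsLinear L M g
    factor-linear {f} {h} {g} f-lin f-ker h-lin fg≈h = linear L M
      (λ {x} {y} x≈y → injective (begin
        f (g x)  ≈⟨ fg≈h x ⟩
        h x      ≈⟨ ⟦⟧-cong h-lin x≈y ⟩
        h y      ≈⟨ fg≈h y ⟨
        f (g y)  ∎))
      (λ x y → injective (begin
        f (g (x L.+ᴹ y))         ≈⟨ fg≈h (x L.+ᴹ y) ⟩
        h (x L.+ᴹ y)             ≈⟨ +ᴹ-homo h-lin x y ⟩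
        h x N.+ᴹ h y             ≈⟨ N.+ᴹ-cong (fg≈h x) (fg≈h y) ⟨
        f (g x) N.+ᴹ f (g y)     ≈⟨ +ᴹ-homo f-lin (g x) (g y) ⟨
        f (g x M.+ᴹ g y)         ∎))
      (λ a x → injective (begin
        f (g (a L.*ₗ x))         ≈⟨ fg≈h (a L.*ₗ x) ⟩
        h (a L.*ₗ x)             ≈⟨ *ₗ-homo h-lin a x ⟩
        a N.*ₗ h x               ≈⟨ N.*ₗ-congˡ (fg≈h x) ⟨
        a N.*ₗ f (g x)           ≈⟨ *ₗ-homo f-lin a (g x) ⟨
        f (a M.*ₗ g x)           ∎))
      where
        injective : ∀ {x y} → f x N.≈ᴹ f y → x M.≈ᴹ y
        injective = kernel⇒injective f-lin f-ker
        open ≈-Reasoning N.≈ᴹ-setoid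

  basis : ∀ {n} → Fin n → Fin n → Carrier
  basis zero    zero    = 1#
  basis zero    (suc j) = 0#
  basis (suc i) zero    = 0#
  basis (suc i) (suc j) = basis i j

  basis-refl : ∀ {n} (i : Fin n) → basis i i ≡ 1#
  basis-refl zero    = ≡.refl
  basis-refl (suc i) = basis-refl i

  cons-0 : ∀ {n} → Submodule (free (ℕ.suc n)) q → Submodule (free n) q
  cons-0 P = record
    { Member    = λ v → Member (0# ∷ v)
    ; resp      = λ v≈w → resp λ { zero → refl ; (suc i) → v≈w i }
    ; 0-closed  = resp (λ { zero → refl ; (suc i) → refl }) 0-closed
    ; +-closed  = λ v∈ w∈ → resp (λ { zero → +-identityˡ 0# ; (suc i) → refl }) (+-closed v∈ w∈)
    ; *ₗ-closed = λ a v∈ → resp (λ { zero → zeroʳ a ; (suc i) → refl }) (*ₗ-closed a v∈)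
    }
    where open Submodule P

  coordinatewise∈ : ∀ {n} (P : Submodule (free n) q) → let open LeftModule (free n) in
                    ∀ v → (∀ i → (v i *ₗ basis i) ∈ Submodule.Member P) → v ∈ Submodule.Member P
  coordinatewise∈ {n = zero}  P v v∈ = resp (λ ()) 0-closed
    where open Submodule P
  coordinatewise∈ {n = suc n} P v v∈ = resp
    (λ { zero    → trans (+-identityʳ _) (*-identityʳ (v zero))
       ; (suc i) → trans (+-congʳ (zeroʳ (v zero))) (+-identityˡ (v (suc i))) })
    (+-closed (v∈ zero) (coordinatewise∈ (cons-0 P) (tail v)
      (λ i → resp (λ { zero → zeroʳ (v (suc i)) ; (suc j) → refl }) (v∈ (suc i)))))
    where open Submodule P

record IsStableDomain (R : CommutativeRing c ℓ) : Set (c ⊔ ℓ) where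
  open CommutativeRing R
  field
    1≉0    : ¬ 1# ≈ 0#
    stable : ∀ x → ¬ ¬ x ≈ 0# → x ≈ 0#
    cancel : ∀ a x → ¬ a ≈ 0# → a * x ≈ 0# → x ≈ 0#

module Rank (R : CommutativeRing c ℓ) (isStableDomain : IsStableDomain R) where
  open CommutativeRing R hiding (zero)
  open IsStableDomain isStableDomain
  open Modules R
  open LinearMaps R
  open RingProperties ring using (-‿+-comm; -‿distribʳ-*; -‿distribˡ-*)
  open CommutativeSemigroupProperties *-commutativeSemigroup using (x∙yz≈y∙xz)

  injective⇒≤ : ∀ {m n} {f : (Fin m → Carrier) → (Fin n → Carrier)} →
                IsLinear (free m) (free n) f → TrivialKernel (free m) (free n) f → m ℕ.≤ n
  injective⇒≤ {zero}  {n}     f-lin f-ker = ℕ.z≤n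
  injective⇒≤ {suc m} {zero}  f-lin f-ker = contradiction (f-ker (basis zero) (λ ()) zero) 1≉0
  injective⇒≤ {suc m} {suc n} {f} f-lin f-ker with suc m ℕP.≤? suc n
  ... | yes m≤n = m≤n
  ... | no  m≰n =
    contradiction (f-ker e (λ r → stable (f e r) (m≰n ∘ ℕ.s≤s ∘ eliminate r)) zero) 1≉0
    where
      e : Fin (suc m) → Carrier
      e = basis zero

      -- If the r-th coordinate of f e is nonzero, eliminating with it embeds
      -- the span of the other basis vectors into the kernel of that coordinate.
      eliminate : ∀ r → ¬ f e r ≈ 0# → m ℕ.≤ n
      eliminate r a≉0 = injective⇒≤ {m} {n} {λ v → f (g v) ∘ punchIn r}
        (linear (free m) (free n)
          (λ v≈w → ⟦⟧-cong fg-lin v≈w ∘ punchIn r)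
          (λ v w → +ᴹ-homo fg-lin v w ∘ punchIn r)
          (λ b v → *ₗ-homo fg-lin b v ∘ punchIn r))
        (λ v hv≈0 i → cancel a (v i) a≉0 (f-ker (g v) (fg-ker v hv≈0) (suc i)))
        where
          a : Carrier
          a = f e r

          g : (Fin m → Carrier) → Fin (suc m) → Carrier
          g v = (- f (0# ∷ v) r) ∷ (λ i → a * v i)

          g-lin : IsLinear (free m) (free (suc m)) g
          g-lin = linear (free m) (free (suc m))
            (λ v≈w → λ { zero    → -‿cong (⟦⟧-cong f-lin (λ { zero → refl ; (suc i) → v≈w i }) r)
                       ; (suc i) → *-congˡ (v≈w i) })
            (λ v w → λ { zero    → trans (-‿cong (trans
                           (⟦⟧-cong f-lin (λ { zero → sym (+-identityˡ 0#) ; (suc i) → refl }) r)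
                           (+ᴹ-homo f-lin (0# ∷ v) (0# ∷ w) r))) (sym (-‿+-comm _ _))
                       ; (suc i) → distribˡ a (v i) (w i) })
            (λ b v → λ { zero    → trans (-‿cong (trans
                           (⟦⟧-cong f-lin (λ { zero → sym (zeroʳ b) ; (suc i) → refl }) r)
                           (*ₗ-homo f-lin b (0# ∷ v) r))) (-‿distribʳ-* b _)
                       ; (suc i) → x∙yz≈y∙xz a b (v i) })

          fg-lin : IsLinear (free m) (free (suc n)) (f ∘ g)
          fg-lin = isLeftModuleHomomorphism (LeftModule.≈ᴹ-trans (free (suc n))) g-lin f-lin

          fg-r≈0 : ∀ v → f (g v) r ≈ 0#
          fg-r≈0 v = begin
            f (g v) r
              ≈⟨ ⟦⟧-cong f-lin (λ { zero    → sym (trans (+-cong (*-identityʳ _) (zeroʳ a)) (+-identityʳ _))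
                                  ; (suc i) → sym (trans (+-congʳ (zeroʳ _)) (+-identityˡ _)) }) r ⟩
            f ((- b) *ₗ e +ᴹ a *ₗ (0# ∷ v)) r     ≈⟨ +ᴹ-homo f-lin _ _ r ⟩
            f ((- b) *ₗ e) r + f (a *ₗ (0# ∷ v)) r
              ≈⟨ +-cong (*ₗ-homo f-lin (- b) e r) (*ₗ-homo f-lin a (0# ∷ v) r) ⟩
            - b * a + a * b                        ≈⟨ +-cong (sym (-‿distribˡ-* b a)) (*-comm a b) ⟩
            - (b * a) + b * a                      ≈⟨ -‿inverseˡ (b * a) ⟩
            0#                                     ∎
            where
              open ≈-Reasoning setoid
              open LeftModule (free (suc m)) using (_+ᴹ_; _*ₗ_)
              b : Carrier
              b = f (0# ∷ v) r

          fg-ker : ∀ v → (∀ i → f (g v) (punchIn r i) ≈ 0#) → ∀ j → f (g v) j ≈ 0#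
          fg-ker v hv≈0 j with r ≟ j
          ... | yes ≡.refl = fg-r≈0 v
          ... | no  r≢j    =
            ≡.subst (λ j → f (g v) j ≈ 0#) (punchIn-punchOut r≢j) (hv≈0 (punchOut r≢j))

  module _ {M : Mod m ℓm} where
    open LeftModule M

    image⊆⇒≤ : ∀ {a b} {f : (Fin a → Carrier) → Carrierᴹ} {g : (Fin b → Carrier) → Carrierᴹ} →
               IsLinear (free a) M f → TrivialKernel (free a) M f →
               IsLinear (free b) M g → TrivialKernel (free b) M g →
               (∀ v → ∃[ w ] g w ≈ᴹ f v) → a ℕ.≤ b
    image⊆⇒≤ {a} {b} {f} {g} f-lin f-ker g-lin g-ker lift = injective⇒≤
      (factor-linear {L = free a} {M = free b} {N = M} g-lin g-ker f-lin (proj₂ ∘ lift))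
      (λ v w≈0 → f-ker v (begin
        f v                ≈⟨ proj₂ (lift v) ⟨
        g (proj₁ (lift v)) ≈⟨ ⟦⟧-cong g-lin w≈0 ⟩
        g (λ _ → 0#)       ≈⟨ 0ᴹ-homo g-lin ⟩
        0ᴹ                 ∎))
      where open ≈-Reasoning ≈ᴹ-setoid

    record Basis (N : Submodule M q) (n : ℕ) : Set (c ⊔ ℓ ⊔ m ⊔ ℓm ⊔ q) where
      open Submodule N
      field
        vec      : (Fin n → Carrier) → Carrierᴹ
        isLinear : IsLinear (free n) M vec
        kernel   : TrivialKernel (free n) M vec
        vec∈     : ∀ v → vec v ∈ Member
        coords   : ∀ {x} → x ∈ Member → ∃[ v ] vec v ≈ᴹ x

    finiteFree⇒basis : {N : Submodule M q} (ff : IsFiniteFree ⟨ N ⟩) → Basis N (proj₁ ff)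
    finiteFree⇒basis {N = N} (n , φ , iso) = record
      { vec      = proj₁ ∘ φ
      ; isLinear = linear (free n) M ⟦φ⟧-cong φ-+ φ-*
      ; kernel   = λ v φv≈0 → φ-injective (≈ᴹ-trans φv≈0 (≈ᴹ-sym φ-0))
      ; vec∈     = proj₂ ∘ φ
      ; coords   = λ x∈ → let v , φv≈ = φ-surjective (_ , x∈) in v , φv≈ (λ _ → refl)
      }
      where
        open LeftModuleMorphisms.IsLeftModuleIsomorphism iso
          using () renaming (⟦⟧-cong to ⟦φ⟧-cong; +ᴹ-homo to φ-+; *ₗ-homo to φ-*; 0ᴹ-homo to φ-0;
                             injective to φ-injective; surjective to φ-surjective)

    module _ {N : Submodule M q} {n : ℕ} (B : Basis N n) where
      open Submodule N
      open Basis B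

      basis⇒stable : ∀ {x} → x ∈ Member → ¬ ¬ x ≈ᴹ 0ᴹ → x ≈ᴹ 0ᴹ
      basis⇒stable {x} x∈ ¬x≉0 with v , φv≈x ← coords x∈ = begin
        x             ≈⟨ φv≈x ⟨
        vec v         ≈⟨ ⟦⟧-cong isLinear (λ i → stable (v i) (λ vi≉0 →
                           ¬x≉0 (λ x≈0 → vi≉0 (kernel v (≈ᴹ-trans φv≈x x≈0) i)))) ⟩
        vec (λ _ → 0#)  ≈⟨ 0ᴹ-homo isLinear ⟩
        0ᴹ            ∎
        where open ≈-Reasoning ≈ᴹ-setoid

      basis⇒cancel : ∀ a {x} → x ∈ Member → ¬ a ≈ 0# → a *ₗ x ≈ᴹ 0ᴹ → x ≈ᴹ 0ᴹ
      basis⇒cancel a {x} x∈ a≉0 ax≈0 with v , φv≈x ← coords x∈ = begin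
        x             ≈⟨ φv≈x ⟨
        vec v         ≈⟨ ⟦⟧-cong isLinear (λ i → cancel a (v i) a≉0
                           (kernel (λ i → a * v i)
                             (≈ᴹ-trans (*ₗ-homo isLinear a v) (≈ᴹ-trans (*ₗ-congˡ φv≈x) ax≈0)) i)) ⟩
        vec (λ _ → 0#)  ≈⟨ 0ᴹ-homo isLinear ⟩
        0ᴹ            ∎
        where open ≈-Reasoning ≈ᴹ-setoid

    module _ {L N : Submodule M q} {l n : ℕ} (BL : Basis L l) (BN : Basis N n)
             (L⊆N : Submodule.Member L ⊆ Submodule.Member N) where
      private
        module L = Submodule L
        module N = Submodule N
        module BL = Basis BL
        module BN = Basis BN
      open ModuleProperties M

      ⊆⇒rank≤ : l ℕ.≤ n
      ⊆⇒rank≤ = image⊆⇒≤ BL.isLinear BL.kernel BN.isLinear BN.kernel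
        (λ v → BN.coords (L⊆N (BL.vec∈ v)))

      torsionQuotient⇒rank≤ : (∀ {x} → x ∈ N.Member → ∃[ a ] (¬ a ≈ 0#) × (a *ₗ x) ∈ L.Member) →
                              n ℕ.≤ l
      torsionQuotient⇒rank≤ torsion = image⊆⇒≤ {f = BN.vec ∘ scale}
        (isLeftModuleHomomorphism ≈ᴹ-trans scale-lin BN.isLinear)
        (λ v fv≈0 i → cancel (a i) (v i) (proj₁ (proj₂ (torsion′ i))) (BN.kernel (scale v) fv≈0 i))
        BL.isLinear BL.kernel
        (λ v → BL.coords (coordinatewise∈ P (scale v) (λ i → P.resp (λ j → begin
          v i * (a i * basis i j)  ≈⟨ *-assoc (v i) (a i) (basis i j) ⟨
          v i * a i * basis i j    ≈⟨ *-congʳ (*-comm (v i) (a i)) ⟩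
          a i * v i * basis i j    ∎)
          (P.*ₗ-closed (v i) {λ j → a i * basis i j}
             (L.resp (≈ᴹ-sym (*ₗ-homo BN.isLinear (a i) (basis i))) (proj₂ (proj₂ (torsion′ i))))))))
        where
          open ≈-Reasoning setoid
          torsion′ : ∀ i → _
          torsion′ i = torsion (BN.vec∈ (basis i))
          a : Fin n → Carrier
          a i = proj₁ (torsion′ i)
          scale : (Fin n → Carrier) → Fin n → Carrier
          scale v i = a i * v i
          scale-lin : IsLinear (free n) (free n) scale
          scale-lin = linear (free n) (free n)
            (λ v≈w i → *-congˡ (v≈w i))
            (λ v w i → distribˡ (a i) (v i) (w i))
            (λ b v i → x∙yz≈y∙xz (a i) b (v i))
          P : Submodule (free n) _
          P = record
            { Member    = λ v → BN.vec v ∈ L.Member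
            ; resp      = λ v≈w → L.resp (⟦⟧-cong BN.isLinear v≈w)
            ; 0-closed  = L.resp (≈ᴹ-sym (0ᴹ-homo BN.isLinear)) L.0-closed
            ; +-closed  = λ {v} {w} v∈ w∈ → L.resp (≈ᴹ-sym (+ᴹ-homo BN.isLinear v w)) (L.+-closed v∈ w∈)
            ; *ₗ-closed = λ b {v} v∈ → L.resp (≈ᴹ-sym (*ₗ-homo BN.isLinear b v)) (L.*ₗ-closed b v∈)
            }
          module P = Submodule P

      rank≡⇒torsionQuotient : l ≡ n → ∀ {x} → x ∈ N.Member →
                              ¬ (∀ a → ¬ a ≈ 0# → ¬ (a *ₗ x) ∈ L.Member)
      rank≡⇒torsionQuotient ≡.refl {x} x∈ torsionFree = ℕP.n≮n l (image⊆⇒≤ {f = f}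
        (linear (free (suc l)) M
          (λ v≈w → +ᴹ-cong (*ₗ-congʳ (v≈w zero)) (⟦⟧-cong BL.isLinear (v≈w ∘ suc)))
          (λ v w → ≈ᴹ-trans
            (+ᴹ-cong (*ₗ-distribʳ x _ _) (+ᴹ-homo BL.isLinear (tail v) (tail w)))
            (interchange _ _ _ _))
          (λ b v → ≈ᴹ-trans
            (+ᴹ-cong (*ₗ-assoc b (v zero) x) (*ₗ-homo BL.isLinear b (tail v)))
            (≈ᴹ-sym (*ₗ-distribˡ b _ _))))
        f-ker BN.isLinear BN.kernel
        (λ v → BN.coords (N.+-closed (N.*ₗ-closed (v zero) x∈) (L⊆N (BL.vec∈ (tail v))))))
        where
          open ≈-Reasoning ≈ᴹ-setoid
          f : (Fin (suc l) → Carrier) → Carrierᴹ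
          f v = v zero *ₗ x +ᴹ BL.vec (tail v)

          f-ker : TrivialKernel (free (suc l)) M f
          f-ker v fv≈0 = λ { zero → v₀≈0 ; (suc i) → BL.kernel (tail v) (begin
            BL.vec (tail v)                 ≈⟨ +ᴹ-identityˡ _ ⟨
            0ᴹ +ᴹ BL.vec (tail v)           ≈⟨ +ᴹ-congʳ (≈ᴹ-trans (*ₗ-congʳ v₀≈0) (*ₗ-zeroˡ x)) ⟨
            v zero *ₗ x +ᴹ BL.vec (tail v)  ≈⟨ fv≈0 ⟩
            0ᴹ                              ∎) i }
            where
              v₀≈0 : v zero ≈ 0#
              v₀≈0 = stable (v zero) (λ v₀≉0 → torsionFree (v zero) v₀≉0
                (L.resp (≈ᴹ-sym (inverseˡ-uniqueᴹ _ _ fv≈0)) (L.-closed (BL.vec∈ (tail v)))))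

module WittRingProperties (k : HeytingField c ℓ ℓ′) {p : ℕ} {W : CommutativeRing w ℓw}
                          (witt : WittRing k p W) where
  open CommutativeRing W hiding (zero)
  open WittRing witt
  open RingProperties ring using (x[y-z]≈xy-xz; -1*x≈-x; -‿+-comm)
  open AbelianGroupProperties +-abelianGroup
    using (⁻¹-anti-homo‿-; //-rightDividesˡ; ∙-cancelˡ; x∙y⁻¹≈ε⇒x≈y; x≈y⇒x∙y⁻¹≈ε)
  open CommutativeSemigroupProperties (CommutativeMonoid.commutativeSemigroup +-commutativeMonoid)
    using (interchange)
  open CommutativeSemigroupProperties *-commutativeSemigroup using (x∙yz≈y∙xz)
  open Exponentiation semiring using (_^_)
  open Divisibility semiring using (_∣_; _,_; _∣0; ∣ʳ-refl; ∣ʳ-trans; ∣ʳ-respʳ-≈; x∣ʳy⇒x∣ʳzy)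
  open SemigroupDivisibility *-commutativeSemigroup using (∙-cong-∣)
  private
    module k where
      open HeytingField k public
      open HeytingProperties (HeytingField.heytingCommutativeRing k) public using (1#0; x-0≈x)
  module residue = RingMorphisms.IsRingHomomorphism isRingHomomorphism
  open ≈-Reasoning setoid

  1≉0 : ¬ 1# ≈ 0#
  1≉0 1≈0 = proj₂ (k.tight k.1# k.0#)
    (k.trans (k.sym residue.1#-homo) (k.trans (residue.⟦⟧-cong 1≈0) residue.0#-homo)) k.1#0

  ϖ^n≉0 : ∀ n → ¬ ϖ ^ n ≈ 0#
  ϖ^n≉0 zero    1≈0 = 1≉0 1≈0
  ϖ^n≉0 (suc n) ≈0  = ϖ^n≉0 n (p-torsionFree (ϖ ^ n) ≈0)

  ϖ∣-stable : ∀ x → ¬ ¬ ϖ ∣ x → ϖ ∣ x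
  ϖ∣-stable x ¬∤ = Equivalence.to (kernel x) (proj₁ (k.tight (residue x) k.0#)
    (λ x#0 → ¬∤ (λ ϖ∣x → proj₂ (k.tight _ _) (Equivalence.from (kernel x) ϖ∣x) x#0)))

  ϖ*-injective : ∀ {x y} → ϖ * x ≈ ϖ * y → x ≈ y
  ϖ*-injective {x} {y} ϖx≈ϖy = x∙y⁻¹≈ε⇒x≈y x y
    (p-torsionFree (x - y) (trans (x[y-z]≈xy-xz ϖ x y)
      (x≈y⇒x∙y⁻¹≈ε ϖx≈ϖy)))

  ϖ*-∣ : ∀ {x y} → ϖ * x ∣ ϖ * y → x ∣ y
  ϖ*-∣ {x} (q , eq) = q , ϖ*-injective (trans (x∙yz≈y∙xz ϖ q x) eq)

  ϖ^n∣-stable : ∀ n x → ¬ ¬ (ϖ ^ n) ∣ x → (ϖ ^ n) ∣ x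
  ϖ^n∣-stable zero    x _  = x , *-identityʳ x
  ϖ^n∣-stable (suc n) x ¬∤
    with y , yϖ≈x ← ϖ∣-stable x (λ ϖ∤x → ¬∤ (ϖ∤x ∘ ∣ʳ-trans (ϖ ^ n , *-comm (ϖ ^ n) ϖ)))
    with ϖy≈x ← trans (*-comm ϖ y) yϖ≈x
    = ∣ʳ-respʳ-≈ ϖy≈x (∙-cong-∣ ∣ʳ-refl (ϖ^n∣-stable n y (λ ∤y →
        ¬∤ (∤y ∘ ϖ*-∣ ∘ ∣ʳ-respʳ-≈ (sym ϖy≈x)))))

  stable : ∀ x → ¬ ¬ x ≈ 0# → x ≈ 0#
  stable x ¬x≉0 = separated x (λ n → ϖ^n∣-stable n x (λ ∤x →
    ¬x≉0 (λ x≈0 → ∤x (∣ʳ-respʳ-≈ (sym x≈0) (_ ∣0)))))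

  ∣-+ : ∀ {d x y} → d ∣ x → d ∣ y → d ∣ (x + y)
  ∣-+ {d} (a , ad≈x) (b , bd≈y) = a + b , trans (distribʳ d a b) (+-cong ad≈x bd≈y)

  telescope : ∀ x y z → (x - y) + (y - z) ≈ x - z
  telescope x y z = trans (sym (+-assoc (x - y) y (- z))) (+-congʳ (//-rightDividesˡ y x))

  -- The geometric series 1 + d + d² + ⋯ converges to the solution.
  geometric : ∀ {d} → ϖ ∣ d → ∃[ x ] x ≈ 1# + d * x
  geometric {d} ϖ∣d =
    let x , limit = complete s step in
    x , x∙y⁻¹≈ε⇒x≈y _ _ (separated _ (λ n →
      ∣ʳ-respʳ-≈ (telescope x (s (suc n)) (1# + d * x)) (∣-+
        (∣ʳ-trans (ϖ , refl) (limit (suc n)))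
        (∣ʳ-respʳ-≈ (sym (affine (s n) x)) (x∣ʳy⇒x∣ʳzy d
          (∣ʳ-respʳ-≈ (flip x (s n)) (x∣ʳy⇒x∣ʳzy (- 1#) (limit n))))))))
    where
      s : ℕ → Carrier
      s zero    = 0#
      s (suc n) = 1# + d * s n

      flip : ∀ x y → - 1# * (x - y) ≈ y - x
      flip x y = trans (-1*x≈-x (x - y)) (⁻¹-anti-homo‿- x y)

      affine : ∀ x y → (1# + d * x) - (1# + d * y) ≈ d * (x - y)
      affine x y = begin
        (1# + d * x) - (1# + d * y)        ≈⟨ +-congˡ (-‿+-comm 1# (d * y)) ⟨
        (1# + d * x) + (- 1# - d * y)      ≈⟨ interchange 1# (d * x) (- 1#) (- (d * y)) ⟩
        (1# - 1#) + (d * x - d * y)        ≈⟨ +-cong (-‿inverseʳ 1#) (sym (x[y-z]≈xy-xz d x y)) ⟩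
        0# + d * (x - y)                   ≈⟨ +-identityˡ _ ⟩
        d * (x - y)                        ∎

      step : ∀ n → (ϖ ^ n) ∣ (s (suc n) - s n)
      step zero    = _ , *-identityʳ _
      step (suc n) = ∣ʳ-respʳ-≈ (sym (affine (s (suc n)) (s n))) (∙-cong-∣ ϖ∣d (step n))

  #⇒unit : ∀ u → residue u k.# k.0# → ∃[ v ] v * u ≈ 1#
  #⇒unit u u#0
    with ū⁻¹ , inverse , _ ← k.#⇒invertible u#0
    with s , s-lifts ← surjective ū⁻¹
    with x , x≈1+dx ← geometric {1# - s * u} (Equivalence.to (kernel (1# - s * u)) (
      k.trans (residue.+-homo 1# _) (k.trans (k.+-cong residue.1#-homo
        (k.trans (residue.-‿homo _) (k.-‿cong (k.trans (residue.*-homo s u)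
          (k.trans (k.*-cong (s-lifts refl) (k.sym (k.x-0≈x (residue u)))) inverse)))))
        (k.-‿inverseʳ k.1#))))
    = x * s , ∙-cancelˡ x _ _ (begin
        x + x * s * u                           ≈⟨ +-cong x≈1+dx (trans (*-assoc x s u) (*-comm x (s * u))) ⟩
        1# + (1# - s * u) * x + s * u * x       ≈⟨ +-assoc _ _ _ ⟩
        1# + ((1# - s * u) * x + s * u * x)     ≈⟨ +-congˡ (sym (distribʳ x _ _)) ⟩
        1# + ((1# - s * u) + s * u) * x         ≈⟨ +-congˡ (trans (*-congʳ (//-rightDividesˡ _ _)) (*-identityˡ x)) ⟩
        1# + x                                  ≈⟨ +-comm 1# x ⟩
        x + 1#                                  ∎)

  ≉0⇒¬¬unit : ∀ u → ¬ residue u k.≈ k.0# → ¬ ¬ (∃[ v ] v * u ≈ 1#)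
  ≉0⇒¬¬unit u ū≉0 ¬unit = ū≉0 (proj₁ (k.tight _ _) (¬unit ∘ #⇒unit u))

  cancel : ∀ a x → ¬ a ≈ 0# → a * x ≈ 0# → x ≈ 0#
  cancel a x a≉0 ax≈0 = separated x ϖ^n∣x
    where
      ϖ^n∣x : ∀ n → (ϖ ^ n) ∣ x
      ϖ^n∣x zero    = x , *-identityʳ x
      ϖ^n∣x (suc n) with y , yϖⁿ≈x ← ϖ^n∣x n = ∣ʳ-respʳ-≈ yϖⁿ≈x
        (∙-cong-∣ ϖ∣y ∣ʳ-refl)
        where
          ay≈0 : a * y ≈ 0#
          ay≈0 = ϖ^n-torsionFree n (begin
            ϖ ^ n * (a * y)  ≈⟨ x∙yz≈y∙xz (ϖ ^ n) a y ⟩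
            a * (ϖ ^ n * y)  ≈⟨ *-congˡ (trans (*-comm (ϖ ^ n) y) yϖⁿ≈x) ⟩
            a * x            ≈⟨ ax≈0 ⟩
            0#               ∎)
            where
              ϖ^n-torsionFree : ∀ n {z} → ϖ ^ n * z ≈ 0# → z ≈ 0#
              ϖ^n-torsionFree zero    {z} eq = trans (sym (*-identityˡ z)) eq
              ϖ^n-torsionFree (suc n) {z} eq =
                ϖ^n-torsionFree n (p-torsionFree _ (trans (sym (*-assoc ϖ (ϖ ^ n) z)) eq))

          ϖ∣y : ϖ ∣ y
          ϖ∣y = ϖ∣-stable y (λ ϖ∤y → ≉0⇒¬¬unit y (ϖ∤y ∘ Equivalence.to (kernel y)) (λ (v , vy≈1) →
            a≉0 (begin
              a            ≈⟨ *-identityʳ a ⟨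
              a * 1#       ≈⟨ *-congˡ vy≈1 ⟨
              a * (v * y)  ≈⟨ x∙yz≈y∙xz a v y ⟩
              v * (a * y)  ≈⟨ *-congˡ ay≈0 ⟩
              v * 0#       ≈⟨ zeroʳ v ⟩
              0#           ∎)))

  isStableDomain : IsStableDomain W
  isStableDomain = record { 1≉0 = 1≉0 ; stable = stable ; cancel = cancel }

  residue-fromℕ : ∀ n → residue (fromℕ W n) k.≈ fromℕ (fieldRing k) n
  residue-fromℕ zero    = residue.0#-homo
  residue-fromℕ (suc n) = k.trans (residue.+-homo _ _) (k.+-cong residue.1#-homo (residue-fromℕ n))

  ∤⇒¬¬unit : HasCharacteristic (fieldRing k) p → ∀ d → ¬ p ℕDivisibility.∣ d →
             ¬ ¬ (∃[ v ] v * fromℕ W d ≈ 1#)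
  ∤⇒¬¬unit char d p∤d = ≉0⇒¬¬unit _ (λ d̄≈0 →
    p∤d (Equivalence.to (char d) (k.trans (k.sym (residue-fromℕ d)) d̄≈0)))

module Filtered (R : CommutativeRing c ℓ) (isStableDomain : IsStableDomain R)
                {M : Modules.Mod R m ℓm} {F : Modules.FiniteFiltration R M q}
                (E : Modules.FilteredEndomorphism R F)
                where
  open CommutativeRing R hiding (zero)
  open Modules R
  open LinearMaps R
  open Rank R isStableDomain
  open LeftModule M
  open ModuleProperties M
  open FiniteFiltration F
  open FilteredEndomorphism E
  open Submodule using (Member; resp; +-closed; *ₗ-closed; -closed)
  open Exponentiation semiring using (_^_)

  rank : ℤ → ℕ
  rank i = proj₁ (finiteFree i)

  basisOf : ∀ i → Basis {M = M} (Fil i) (rank i)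
  basisOf i = finiteFree⇒basis (finiteFree i)

  stableᴹ : ∀ x → ¬ ¬ x ≈ᴹ 0ᴹ → x ≈ᴹ 0ᴹ
  stableᴹ x = let i , x∈ = exhaustive x in basis⇒stable (basisOf i) x∈

  cancelᴹ : ∀ a x → ¬ a ≈ 0# → a *ₗ x ≈ᴹ 0ᴹ → x ≈ᴹ 0ᴹ
  cancelᴹ a x = let i , x∈ = exhaustive x in basis⇒cancel (basisOf i) a x∈

  pred⊆ : ∀ i → Member (Fil (ℤ.pred i)) ⊆ Member (Fil i)
  pred⊆ i {x} x∈ = ≡.subst (λ j → x ∈ Member (Fil j)) (ℤP.suc-pred i) (increasing (ℤ.pred i) x∈)

  rank≢⇒HT : ∀ s → (∀ n → ¬ s ^ n ≈ 0#) → ∀ i → ¬ rank (ℤ.pred i) ≡ rank i → i ∈ HT s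
  rank≢⇒HT s s^n≉0 i rank≢ isZero = rank≢ (ℕP.≤-antisym
    (⊆⇒rank≤ BL BN (pred⊆ i))
    (torsionQuotient⇒rank≤ BL BN (pred⊆ i) λ {x} x∈ →
      let l , ∈pred = isZero ((x , x∈) , 0) in
      s ^ (l ℕ.+ 0) , s^n≉0 (l ℕ.+ 0) , resp (Fil (ℤ.pred i)) (begin
        s ^ (l ℕ.+ 0) *ₗ x -ᴹ s ^ (l ℕ.+ 0) *ₗ 0ᴹ  ≈⟨ -ᴹ-cong ≈ᴹ-refl (*ₗ-zeroʳ _) ⟩
        s ^ (l ℕ.+ 0) *ₗ x -ᴹ 0ᴹ                   ≈⟨ +ᴹ-congˡ -0≈0 ⟩
        s ^ (l ℕ.+ 0) *ₗ x +ᴹ 0ᴹ                   ≈⟨ +ᴹ-identityʳ _ ⟩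
        s ^ (l ℕ.+ 0) *ₗ x                         ∎) ∈pred))
    where
      open ≈-Reasoning ≈ᴹ-setoid
      BL = basisOf (ℤ.pred i)
      BN = basisOf i

  shift : Carrier → Carrierᴹ → Carrierᴹ
  shift a x = Θ x -ᴹ a *ₗ x

  shift-linear : ∀ a → IsLinear M M (shift a)
  shift-linear a = linear M M
    (λ x≈y → -ᴹ-cong (⟦⟧-cong isLinear x≈y) (*ₗ-congˡ x≈y))
    (λ x y → begin
      Θ (x +ᴹ y) -ᴹ a *ₗ (x +ᴹ y)             ≈⟨ -ᴹ-cong (+ᴹ-homo isLinear x y) (*ₗ-distribˡ a x y) ⟩
      Θ x +ᴹ Θ y -ᴹ (a *ₗ x +ᴹ a *ₗ y)        ≈⟨ +ᴹ-congˡ (-ᴹ-distrib _ _) ⟨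
      Θ x +ᴹ Θ y +ᴹ (-ᴹ (a *ₗ x) -ᴹ a *ₗ y)   ≈⟨ interchange _ _ _ _ ⟩
      shift a x +ᴹ shift a y                  ∎)
    (λ b x → begin
      Θ (b *ₗ x) -ᴹ a *ₗ b *ₗ x    ≈⟨ -ᴹ-cong (*ₗ-homo isLinear b x) (*ₗ-comm a b x) ⟩
      b *ₗ Θ x -ᴹ b *ₗ a *ₗ x      ≈⟨ *ₗ-distribˡ-ᴹ b (Θ x) (a *ₗ x) ⟨
      b *ₗ shift a x               ∎)
    where open ≈-Reasoning ≈ᴹ-setoid

  linear⇒-ᴹ-homo : ∀ {f} → IsLinear M M f → ∀ x y → f (x -ᴹ y) ≈ᴹ f x -ᴹ f y
  linear⇒-ᴹ-homo f-lin x y = ≈ᴹ-trans (+ᴹ-homo f-lin x (-ᴹ y)) (+ᴹ-congˡ (-ᴹ-homo f-lin y))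

  shift-comm : ∀ a b x → shift a (shift b x) ≈ᴹ shift b (shift a x)
  shift-comm a b x = begin
    shift a (Θ x -ᴹ b *ₗ x)                ≈⟨ linear⇒-ᴹ-homo (shift-linear a) (Θ x) (b *ₗ x) ⟩
    Θ (Θ x) -ᴹ a *ₗ Θ x -ᴹ shift a (b *ₗ x)
      ≈⟨ -ᴹ-cong (-ᴹ-cong ≈ᴹ-refl (≈ᴹ-sym (*ₗ-homo isLinear a x))) (*ₗ-homo (shift-linear a) b x) ⟩
    Θ (Θ x) -ᴹ Θ (a *ₗ x) -ᴹ b *ₗ shift a x  ≈⟨ +ᴹ-congʳ (linear⇒-ᴹ-homo isLinear (Θ x) (a *ₗ x)) ⟨
    shift b (shift a x)                    ∎
    where open ≈-Reasoning ≈ᴹ-setoid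

  -ᴹ-closed : ∀ i {x y} → x ∈ Member (Fil i) → y ∈ Member (Fil i) → (x -ᴹ y) ∈ Member (Fil i)
  -ᴹ-closed i x∈ y∈ = +-closed (Fil i) x∈ (-closed (Fil i) y∈)

  shift-closed : ∀ a i {x} → x ∈ Member (Fil i) → shift a x ∈ Member (Fil i)
  shift-closed a i x∈ = -ᴹ-closed i (preserves i x∈) (*ₗ-closed (Fil i) a x∈)

  shift-difference : ∀ {a b} u → b ≈ a + u → ∀ x → shift a x -ᴹ shift b x ≈ᴹ u *ₗ x
  shift-difference {a} {b} u b≈a+u x = begin
    shift a x -ᴹ shift b x
      ≈⟨ -ᴹ-cong ≈ᴹ-refl shift-b ⟩
    shift a x -ᴹ (shift a x -ᴹ u *ₗ x)      ≈⟨ +ᴹ-congˡ (⁻¹-anti-homo‿- _ _) ⟩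
    shift a x +ᴹ (u *ₗ x -ᴹ shift a x)      ≈⟨ +ᴹ-assoc _ _ _ ⟨
    shift a x +ᴹ u *ₗ x -ᴹ shift a x        ≈⟨ xyx⁻¹≈y _ _ ⟩
    u *ₗ x                                  ∎
    where
      open ≈-Reasoning ≈ᴹ-setoid
      open AbelianGroupProperties +ᴹ-abelianGroup using (⁻¹-anti-homo‿-; xyx⁻¹≈y)
      shift-b : shift b x ≈ᴹ shift a x -ᴹ u *ₗ x
      shift-b = begin
        Θ x -ᴹ b *ₗ x                       ≈⟨ -ᴹ-cong ≈ᴹ-refl (≈ᴹ-trans (*ₗ-congʳ b≈a+u) (*ₗ-distribʳ x a u)) ⟩
        Θ x -ᴹ (a *ₗ x +ᴹ u *ₗ x)           ≈⟨ +ᴹ-congˡ (-ᴹ-distrib _ _) ⟨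
        Θ x +ᴹ (-ᴹ (a *ₗ x) -ᴹ u *ₗ x)      ≈⟨ +ᴹ-assoc _ _ _ ⟨
        shift a x -ᴹ u *ₗ x                 ∎

  -- A filtered left inverse of Θ - a on Fil j, defined on all of M.
  record LeftInverse (a : Carrier) (j : ℤ) : Set (c ⊔ m ⊔ ℓm ⊔ q) where
    field
      S       : Carrierᴹ → Carrierᴹ
      S-cong  : ∀ {x y} → x ≈ᴹ y → S x ≈ᴹ S y
      S-*     : ∀ b x → S (b *ₗ x) ≈ᴹ b *ₗ S x
      closed  : ∀ i {x} → x ∈ Member (Fil i) → S x ∈ Member (Fil i)
      inverse : ∀ {x} → x ∈ Member (Fil j) → S (shift a x) ≈ᴹ x

  module _ {a : Carrier} where
    zero⇒leftInverse : ∀ {j} → IsZero ⟨ Fil j ⟩ → LeftInverse a j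
    zero⇒leftInverse isZero = record
      { S       = λ _ → 0ᴹ
      ; S-cong  = λ _ → ≈ᴹ-refl
      ; S-*     = λ b _ → ≈ᴹ-sym (*ₗ-zeroʳ b)
      ; closed  = λ i _ → Submodule.0-closed (Fil i)
      ; inverse = λ x∈ → ≈ᴹ-sym (isZero (_ , x∈))
      }

    unit⇒leftInverse : ∀ {i j b v} u → b ≈ a + u → v * u ≈ 1# →
                       (∀ {x} → x ∈ Member (Fil j) → shift b x ∈ Member (Fil i)) →
                       LeftInverse a i → LeftInverse a j
    unit⇒leftInverse {b = b} {v} u b≈a+u vu≈1 shift∈ I = record
      { S       = λ x → v *ₗ (x -ᴹ S (shift b x))
      ; S-cong  = λ x≈y → *ₗ-congˡ (-ᴹ-cong x≈y (S-cong (⟦⟧-cong (shift-linear b) x≈y)))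
      ; S-*     = λ d x → begin
          v *ₗ (d *ₗ x -ᴹ S (shift b (d *ₗ x)))  ≈⟨ *ₗ-congˡ (-ᴹ-cong ≈ᴹ-refl
                                                      (≈ᴹ-trans (S-cong (*ₗ-homo (shift-linear b) d x)) (S-* d _))) ⟩
          v *ₗ (d *ₗ x -ᴹ d *ₗ S (shift b x))    ≈⟨ *ₗ-congˡ (*ₗ-distribˡ-ᴹ d x _) ⟨
          v *ₗ d *ₗ (x -ᴹ S (shift b x))         ≈⟨ *ₗ-comm v d _ ⟩
          d *ₗ v *ₗ (x -ᴹ S (shift b x))         ∎
      ; closed  = λ i x∈ → *ₗ-closed (Fil i) v (-ᴹ-closed i x∈ (closed i (shift-closed b i x∈)))
      ; inverse = λ {x} x∈ → begin
          v *ₗ (shift a x -ᴹ S (shift b (shift a x)))  ≈⟨ *ₗ-congˡ (-ᴹ-cong ≈ᴹ-refl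
                                                           (≈ᴹ-trans (S-cong (shift-comm b a x)) (inverse (shift∈ x∈)))) ⟩
          v *ₗ (shift a x -ᴹ shift b x)                ≈⟨ *ₗ-congˡ (shift-difference u b≈a+u x) ⟩
          v *ₗ u *ₗ x                                  ≈⟨ *ₗ-assoc v u x ⟨
          (v * u) *ₗ x                                 ≈⟨ *ₗ-congʳ vu≈1 ⟩
          1# *ₗ x                                      ≈⟨ *ₗ-identityˡ x ⟩
          x                                            ∎
      }
      where
        open LeftInverse I
        open ≈-Reasoning ≈ᴹ-setoid

    torsion-inverse : ∀ {i} (I : LeftInverse a i) {d x} → ¬ d ≈ 0# →
                      (d *ₗ x) ∈ Member (Fil i) → LeftInverse.S I (shift a x) ≈ᴹ x
    torsion-inverse I {d} {x} d≉0 dx∈ = x-y≈0⇒x≈y _ _ (cancelᴹ d _ d≉0 (begin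
      d *ₗ (S (shift a x) -ᴹ x)         ≈⟨ *ₗ-distribˡ-ᴹ d _ x ⟩
      d *ₗ S (shift a x) -ᴹ d *ₗ x      ≈⟨ x≈y⇒x-y≈0 (begin
        d *ₗ S (shift a x)    ≈⟨ S-* d _ ⟨
        S (d *ₗ shift a x)    ≈⟨ S-cong (*ₗ-homo (shift-linear a) d x) ⟨
        S (shift a (d *ₗ x))  ≈⟨ inverse dx∈ ⟩
        d *ₗ x                ∎) ⟩
      0ᴹ                                ∎))
      where
        open LeftInverse I
        open ≈-Reasoning ≈ᴹ-setoid

    rank≡⇒leftInverse : ∀ {j} → rank (ℤ.pred j) ≡ rank j →
                        LeftInverse a (ℤ.pred j) → LeftInverse a j
    rank≡⇒leftInverse {j} rank≡ I = record
      { S = S ; S-cong = S-cong ; S-* = S-* ; closed = closed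
      ; inverse = λ x∈ → x-y≈0⇒x≈y _ _ (stableᴹ _ (λ ≉0 →
          rank≡⇒torsionQuotient (basisOf (ℤ.pred j)) (basisOf j) (pred⊆ j) rank≡ x∈
            (λ d d≉0 dx∈ → ≉0 (x≈y⇒x-y≈0 (torsion-inverse I d≉0 dx∈)))))
      }
      where open LeftInverse I

    leftInverse⇒torsionIsZero : ∀ {i} → (∀ {x} → x ∈ Member (Fil i) → shift a x ∈ Member (Fil (ℤ.pred i))) →
                                LeftInverse a (ℤ.pred i) → TorsionIsZero (gr i)
    leftInverse⇒torsionIsZero {i} shift∈ I (x , x∈) (d , d≉0 , dx∼0) = resp (Fil (ℤ.pred i)) (begin
      S (shift a x)  ≈⟨ torsion-inverse I d≉0 (resp (Fil (ℤ.pred i)) (x-0≈x (d *ₗ x)) dx∼0) ⟩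
      x              ≈⟨ x-0≈x x ⟨
      x -ᴹ 0ᴹ        ∎)
      (closed (ℤ.pred i) (shift∈ x∈))
      where
        open LeftInverse I
        open ≈-Reasoning ≈ᴹ-setoid
        x-0≈x : ∀ y → y -ᴹ 0ᴹ ≈ᴹ y
        x-0≈x y = ≈ᴹ-trans (+ᴹ-congˡ -0≈0) (+ᴹ-identityʳ y)

module FromInteger (R : CommutativeRing c ℓ) where
  open CommutativeRing R hiding (zero)
  open RingProperties ring using (-‿+-comm)
  open AbelianGroupProperties +-abelianGroup using (\\-leftDividesˡ)

  fromℤ-suc : ∀ z → fromℤ R (ℤ.suc z) ≈ 1# + fromℤ R z
  fromℤ-suc (+ n)          = refl
  fromℤ-suc -[1+ zero ]    = sym (trans (+-congˡ (-‿cong (+-identityʳ 1#))) (-‿inverseʳ 1#))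
  fromℤ-suc -[1+ suc n ]   = sym (trans (+-congˡ (sym (-‿+-comm 1# _))) (\\-leftDividesˡ 1# _))

  fromℤ-neg-pred : ∀ z → fromℤ R (ℤ.- ℤ.pred z) ≈ 1# + fromℤ R (ℤ.- z)
  fromℤ-neg-pred z rewrite ℤP.neg-distrib-+ ℤ.-1ℤ z = fromℤ-suc (ℤ.- z)

-- i - d, in a form such that gr (below i d) is a quotient by Fil (below i (suc d)) definitionally.
below : ℤ → ℕ → ℤ
below i zero    = i
below i (suc d) = ℤ.pred (below i d)

below+ : ∀ i d → below i d ℤ.+ + d ≡ i
below+ i zero    = ℤP.+-identityʳ i
below+ i (suc d) = ≡.trans (≡.cong (ℤ._+ + suc d) (ℤP.+-comm ℤ.-1ℤ (below i d)))
  (≡.trans (ℤP.+-assoc (below i d) ℤ.-1ℤ (+ suc d)) (below+ i d))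

i≤+∣i∣ : ∀ i → i ℤ.≤ + ℤ.∣ i ∣
i≤+∣i∣ (+ n)    = ℤP.≤-refl
i≤+∣i∣ -[1+ n ] = ℤ.-≤+

below-≤ : ∀ i b → below i (suc ℤ.∣ i ℤ.- b ∣) ℤ.≤ b
below-≤ i b = ℤP.≤-trans (ℤP.i≤j⇒pred[i]≤j ℤP.≤-refl) (begin
  below i N                    ≡⟨ ℤP.+-identityʳ _ ⟨
  below i N ℤ.+ ℤ.0ℤ           ≡⟨ ≡.cong (ℤ._+_ (below i N)) (ℤP.+-inverseʳ (+ N)) ⟨
  below i N ℤ.+ (+ N ℤ.- + N)  ≡⟨ ℤP.+-assoc (below i N) (+ N) _ ⟨
  below i N ℤ.+ + N ℤ.- + N    ≡⟨ ≡.cong (ℤ._- + N) (below+ i N) ⟩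
  i ℤ.- + N                    ≤⟨ ℤP.+-monoʳ-≤ i (ℤP.neg-mono-≤ (i≤+∣i∣ (i ℤ.- b))) ⟩
  i ℤ.- (i ℤ.- b)              ≡⟨ ≡.cong (ℤ._+_ i) (ℤ⁻¹.⁻¹-anti-homo‿- i b) ⟩
  i ℤ.+ (b ℤ.- i)              ≡⟨ ℤP.+-assoc i b (ℤ.- i) ⟨
  i ℤ.+ b ℤ.- i                ≡⟨ ℤ⁻¹.xyx⁻¹≈y i b ⟩
  b                            ∎)
  where
    open ℤP.≤-Reasoning
    module ℤ⁻¹ = AbelianGroupProperties ℤP.+-0-abelianGroup
    N = ℤ.∣ i ℤ.- b ∣

module _ (R : CommutativeRing c ℓ) where
  open CommutativeRing R hiding (zero)
  open FromInteger R

  fromℤ-neg-below : ∀ i d → fromℤ R (ℤ.- below i d) ≈ fromℤ R (ℤ.- i) + fromℕ R d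
  fromℤ-neg-below i zero    = sym (+-identityʳ _)
  fromℤ-neg-below i (suc d) = trans (fromℤ-neg-pred (below i d))
    (trans (+-congˡ (fromℤ-neg-below i d)) (x∙yz≈y∙xz 1# _ _))
    where
      open CommutativeSemigroupProperties
        (CommutativeMonoid.commutativeSemigroup +-commutativeMonoid) using (x∙yz≈y∙xz)

proposition2p1 : ∀ {c ℓ ℓ′ w ℓw m ℓm q : Level}
    (k : HeytingField c ℓ ℓ′) (p : ℕ) → 0 ℕ.< p →
    HasCharacteristic (fieldRing k) p → IsPerfect (fieldRing k) p →
    (𝒪 : CommutativeRing w ℓw) → WittRing k p 𝒪 →
    let open Modules 𝒪 in
    (M : Mod m ℓm) (F : FiniteFiltration M q) →
    let open FiniteFiltration F in
    (Θ : FilteredEndomorphism F) → ActsOnGrByNegIndex Θ →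
    ∀ (i : ℤ) → ¬ TorsionIsZero (gr i) →
    ∃[ r ] ∃[ n ] ((r ∈ HT (fromℕ 𝒪 p)) × (+ 0 ℤ.< n) × (i ≡ r ℤ.+ n ℤ.* + p))
proposition2p1 k p 0<p char perfect 𝒪 witt M F Θ acts i torsion≢0 =
  let b , Fil≡0 = vanishes in
  conclude (search b Fil≡0 ℤ.∣ i ℤ.- b ∣ 0
    (≡.subst (λ d → below i d ℤ.≤ b) (ℕP.+-comm 1 ℤ.∣ i ℤ.- b ∣) (below-≤ i b)))
  where
    open Modules 𝒪
    open FiniteFiltration F
    open WittRingProperties k witt
    open Filtered 𝒪 isStableDomain Θ

    Conclusion : Set _
    Conclusion = ∃[ r ] ∃[ n ] ((r ∈ HT (fromℕ 𝒪 p)) × (+ 0 ℤ.< n) × (i ≡ r ℤ.+ n ℤ.* + p))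

    a : CommutativeRing.Carrier 𝒪
    a = fromℤ 𝒪 (ℤ.- i)

    shift∈ : ∀ j {x} → x ∈ Submodule.Member (Fil j) →
             shift (fromℤ 𝒪 (ℤ.- j)) x ∈ Submodule.Member (Fil (ℤ.pred j))
    shift∈ j x∈ = acts j (_ , x∈)

    -- Going up from where the filtration vanishes, either an index congruent
    -- to i modulo p turns out to be in HT, or Θ + i is left invertible so far.
    search : ∀ b → (∀ j → j ℤ.≤ b → IsZero ⟨ Fil j ⟩) →
             ∀ n d → below i (n ℕ.+ suc d) ℤ.≤ b →
             Conclusion ⊎ ¬ ¬ LeftInverse a (below i (suc d))
    search b Fil≡0 zero    d ≤b = inj₂ λ ¬I → ¬I (zero⇒leftInverse (Fil≡0 _ ≤b))
    search b Fil≡0 (suc n) d ≤b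
      with search b Fil≡0 n (suc d) (≡.subst (λ e → below i e ℤ.≤ b) (≡.sym (ℕP.+-suc n (suc d))) ≤b)
    ... | inj₁ found = inj₁ found
    ... | inj₂ ¬¬I with p ℕDivisibility.∣? suc d
    ...   | no p∤d = inj₂ λ ¬I′ → ¬¬I λ I → ∤⇒¬¬unit char (suc d) p∤d λ (v , vu≈1) →
              ¬I′ (unit⇒leftInverse (fromℕ 𝒪 (suc d)) (fromℤ-neg-below 𝒪 i (suc d)) vu≈1
                (shift∈ (below i (suc d))) I)
    ...   | yes (ℕDivisibility.divides (suc n) d≡np) with rank (below i (suc (suc d))) ℕP.≟ rank (below i (suc d))
    ...     | yes rank≡ = inj₂ λ ¬I′ → ¬¬I (¬I′ ∘ rank≡⇒leftInverse rank≡)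
    ...     | no  rank≢ = inj₁ (below i (suc d) , + suc n , rank≢⇒HT _ ϖ^n≉0 _ rank≢ , ℤ.+<+ ℕ.z<s ,
                ≡.trans (≡.sym (below+ i (suc d))) (≡.cong (ℤ._+_ (below i (suc d)))
                  (≡.trans (≡.cong +_ d≡np) (ℤP.pos-* (suc n) p))))

    conclude : Conclusion ⊎ ¬ ¬ LeftInverse a (ℤ.pred i) → Conclusion
    conclude (inj₁ found) = found
    conclude (inj₂ ¬¬I)   = contradiction (λ I → torsion≢0 (leftInverse⇒torsionIsZero (shift∈ i) I)) ¬¬I
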